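{- Let $\Gamma$ be a finite group, let $\Gamma_1$ be a normal subgroup of $\Gamma$, let $n\ge 4$, and let $M$ be an elementary lift of the frame matroid $F(K_n^{\Gamma},\psi_n^{\Gamma}/\Gamma_1)$ such that a cycle of $K_n^\Gamma$ is a circuit of $M$ if and only if it is $\psi_n^\Gamma$-balanced. Then there is a collection $\mathcal A$ of subgroups of $\Gamma$ such that $\{\Gamma_1\}\cup\mathcal A$ is a partition of $\Gamma$, each $A\in\mathcal A$ is malnormal and every conjugate of every $A\in\mathcal A$ is in $\mathcal A$, and $M=M(\Gamma,\Gamma_1,\mathcal A,K_n^\Gamma,\psi_n^\Gamma)$.
   Context: $K_n^\Gamma$ is the graph with vertices $v_1,\dots,v_n$ and, for each $1\le i<j\le n$ and each $\alpha\in\Gamma$, an edge $\alpha_{ij}$ with ends $v_i,v_j$; $\psi_n^\Gamma$ is the $\Gamma$-gain function with $\psi_n^\Gamma(\alpha_{ij},v_i,v_j)=\alpha$ (and $\psi_n^\Gamma(\alpha_{ij},v_j,v_i)=\alpha^{ -1}$). General conventions: an oriented edge is a triple $(e,u,v)$ with $e$ an edge with ends $u,v$; a $\Gamma$-gain function $\psi$ assigns to oriented edges elements of $\Gamma$ with $\psi(e,u,v)=\psi(e,v,u)^{ -1}$ for $u\neq v$. For a walk $W=v_1,e_1,\dots,e_k,v_{k+1}$, $\psi(W)=\prod_i\psi(e_i,v_i,v_{i+1})$. A cycle is $\psi$-balanced if a simple closed walk $W$ around it has $\psi(W)$ equal to the identity $\varepsilon$. $\psi(e)$ is the set of values of the orientations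 of $e$ and $\psi(X)=\bigcup_{e\in X}\psi(e)$. For $\eta:V(G)\to\Gamma$, $\psi^\eta(e,u,v)=\eta(u)^{ -1}\psi(e,u,v)\eta(v)$. $\psi/\Gamma_1$ is $\psi$ composed with the quotient map $\Gamma\to\Gamma/\Gamma_1$. $G[X]$ is the subgraph formed by the edges in $X$ and their ends. A partition of $\Gamma$ is a collection of subgroups such that every non-identity element lies in exactly one of them; $A$ is malnormal if $\gamma^{ -1}A\gamma\cap A=\{\varepsilon\}$ for all $\gamma\notin A$. Frame matroid: for a gain graph $(G,\varphi)$, $F(G,\varphi)$ is the matroid on $E(G)$ whose circuits are the $\varphi$-balanced cycles, tight handcuffs (two edge-disjoint cycles sharing exactly one vertex) and loose handcuffs (two vertex-disjoint cycles joined by a minimal path) with both cycles unbalanced, and theta graphs (three internally disjoint paths between two distinct vertices) with all three cycles unbalanced. An elementary lift of a matroid $N$ is a matroid $M$ with $K\setminus e=M$, $K/e=N$ for some matroid $K$ and element $e$. Construction: for a group $\Gamma$, normal subgroup $\Gamma_1$, a collection $\mathcal A$ as in the claim, and a $\Gamma$-gain graph $(G,\psi)$, let $N=F(G,\psi/\Gamma_1)$ and let $\mathcal C(\Gamma,\Gamma_1,\mathcal A,G,\psi)$ be the set of circuits $C$ of $N$ that are $\psi$-balanced cycles, or are handcuffs or theta graphs for which there are a switching function $\eta$ and $A\in\mathcal A$ with $\psi^\eta(C)\subseteq A$. Then $M(\Gamma,\Gamma_1,\mathcal A,G,\psi)$ is the matroid on $E(G)$ with rank function $r(X)=r_N(X)$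 if every circuit of $N|X$ lies in $\mathcal C(\Gamma,\Gamma_1,\mathcal A,G,\psi)$ and $r(X)=r_N(X)+1$ otherwise (this is a matroid and an elementary lift of $N$). -}

module Defs where

open import Data.Nat using (ℕ; zero; suc; _+_; _≤_; _<_; _<ᵇ_)
open import Data.Bool using (Bool; true; false; if_then_else_)
open import Data.Fin using (Fin; toℕ)
open import Data.Fin.Subset using (Subset; inside; outside; ⊥; _∪_; _∩_; ∣_∣; _⊆_; _⊂_)
  renaming (_∈_ to _∈ₛ_)
open import Data.Vec using (_∷_)
open import Data.List using (List; []; _∷_; map; length; lookup; concatMap; allFin; foldr; _++_; reverse)
open import Data.List.Relation.Unary.Unique.Propositional using (Unique)
open import Data.List.Membership.Propositional using (_∈_; _∉_)
open import Data.List.Relation.Unary.All using (All)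
open import Data.Product using (Σ; ∃; ∃-syntax; _×_; _,_; proj₁; proj₂)
open import Data.Sum using (_⊎_)
open import Data.Unit using (⊤)
open import Relation.Nullary using (¬_)
open import Relation.Binary.PropositionalEquality using (_≡_; _≢_)
open import Algebra.Structures using (IsGroup)
open import Function.Bundles using (_↔_; Inverse; _⇔_)

record FiniteGroup : Set₁ where
  infixl 7 _∙_
  infix 8 _⁻¹
  field
    Carrier     : Set
    _∙_         : Carrier → Carrier → Carrier
    ε           : Carrier
    _⁻¹         : Carrier → Carrier
    isGroup     : IsGroup _≡_ _∙_ ε _⁻¹
    size        : ℕ
    enumeration : Carrier ↔ Fin size

  code : Carrier → Fin size
  code = Inverse.to enumeration

  decode : Fin size → Carrier
  decode = Inverse.from enumeration

  elements : List Carrier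
  elements = map decode (allFin size)

  GSubset : Set
  GSubset = Subset size

  infix 4 _∈Γ_ _∉Γ_
  _∈Γ_ : Carrier → GSubset → Set
  x ∈Γ S = code x ∈ₛ S

  _∉Γ_ : Carrier → GSubset → Set
  x ∉Γ S = ¬ (x ∈Γ S)

module _ (Γ : FiniteGroup) where
  open FiniteGroup Γ

  IsSubgroup : GSubset → Set
  IsSubgroup S = (ε ∈Γ S)
               × (∀ x y → x ∈Γ S → y ∈Γ S → x ∙ y ∈Γ S)
               × (∀ x → x ∈Γ S → x ⁻¹ ∈Γ S)

  IsNormalSubgroup : GSubset → Set
  IsNormalSubgroup S = IsSubgroup S × (∀ g h → h ∈Γ S → g ⁻¹ ∙ h ∙ g ∈Γ S)

  InConjugate : Carrier → GSubset → Carrier → Set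
  InConjugate γ A x = ∃[ a ] (a ∈Γ A × x ≡ γ ⁻¹ ∙ a ∙ γ)

  IsMalnormal : GSubset → Set
  IsMalnormal A = ∀ γ → γ ∉Γ A → ∀ x → x ∈Γ A → InConjugate γ A x → x ≡ ε

  ConjugationClosed : List GSubset → Set
  ConjugationClosed 𝒜 =
    ∀ A → A ∈ 𝒜 → ∀ γ → ∃[ B ] (B ∈ 𝒜 × (∀ x → (x ∈Γ B) ⇔ InConjugate γ A x))

  IsPartition : List GSubset → Set
  IsPartition 𝒫 =
    All IsSubgroup 𝒫 ×
    (∀ γ → γ ≢ ε →
       (∃[ P ] (P ∈ 𝒫 × γ ∈Γ P)) ×
       (∀ P Q → P ∈ 𝒫 → Q ∈ 𝒫 → γ ∈Γ P → γ ∈Γ Q → P ≡ Q))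

record Matroid (m : ℕ) : Set where
  field
    rank        : Subset m → ℕ
    rank-bound  : ∀ X → rank X ≤ ∣ X ∣
    rank-mono   : ∀ {X Y} → X ⊆ Y → rank X ≤ rank Y
    rank-submod : ∀ X Y → rank (X ∪ Y) + rank (X ∩ Y) ≤ rank X + rank Y

open Matroid public

IsCircuit : ∀ {m} → Matroid m → Subset m → Set
IsCircuit M C = (rank M C < ∣ C ∣) × (∀ Y → Y ⊂ C → rank M Y ≡ ∣ Y ∣)

-- M is an elementary lift of N: there is K on E ∪ {e} (e = the new element
-- zero of Fin (suc m)) with K \ e = M and K / e = N.
-- Rank of K\e at X is r_K(X); rank of K/e at X is r_K(X ∪ e) - r_K(e).
IsElementaryLift : ∀ {m} → Matroid m → Matroid m → Set
IsElementaryLift {m} M N =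
  ∃[ K ] ((∀ X → rank M X ≡ rank K (outside ∷ X)) ×
          (∀ X → rank K (inside ∷ X) ≡ rank N X + rank K (inside ∷ ⊥)))
  where K : Set
        K = Matroid (suc m)

module _ (Γ : FiniteGroup) (n : ℕ) where
  open FiniteGroup Γ

  edgeTriples : List (Fin n × Fin n × Carrier)
  edgeTriples =
    concatMap (λ i → concatMap (λ j →
        if toℕ i <ᵇ toℕ j then map (λ α → (i , j , α)) elements else [])
      (allFin n)) (allFin n)

  nEdges : ℕ
  nEdges = length edgeTriples

  Edge : Set
  Edge = Fin nEdges

  end₁ end₂ : Edge → Fin n
  end₁ e = proj₁ (lookup edgeTriples e)
  end₂ e = proj₁ (proj₂ (lookup edgeTriples e))

  label : Edge → Carrier
  label e = proj₂ (proj₂ (lookup edgeTriples e))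

  -- an oriented edge: (e , true) = (e, v_i, v_j), (e , false) = (e, v_j, v_i)
  Step : Set
  Step = Edge × Bool

  tailS headS : Step → Fin n
  tailS (e , true)  = end₁ e
  tailS (e , false) = end₂ e
  headS (e , true)  = end₂ e
  headS (e , false) = end₁ e

  ψ : Step → Carrier
  ψ (e , true)  = label e
  ψ (e , false) = label e ⁻¹

  ψ^ : (Fin n → Carrier) → Step → Carrier
  ψ^ η s = η (tailS s) ⁻¹ ∙ ψ s ∙ η (headS s)

  IsWalk : Fin n → Fin n → List Step → Set
  IsWalk u v []       = u ≡ v
  IsWalk u v (s ∷ ss) = (tailS s ≡ u) × IsWalk (headS s) v ss

  walkValue : List Step → Carrier
  walkValue = foldr (λ s acc → ψ s ∙ acc) ε

  walkVertices : Fin n → List Step → List (Fin n)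
  walkVertices u ss = u ∷ map headS ss

  walkEdges : List Step → List Edge
  walkEdges = map proj₁

  flip : Step → Step
  flip (e , true)  = (e , false)
  flip (e , false) = (e , true)

  reverseWalk : List Step → List Step
  reverseWalk ss = reverse (map flip ss)

  record Path (u v : Fin n) : Set where
    field
      steps    : List Step
      isWalk   : IsWalk u v steps
      distinct : Unique (walkVertices u steps)

  record Cycle : Set where
    field
      start     : Fin n
      steps     : List Step
      isWalk    : IsWalk start start steps
      nonempty  : steps ≢ []
      distinctV : Unique (map tailS steps)
      distinctE : Unique (walkEdges steps)
    vertices : List (Fin n)
    vertices = map tailS steps
    edges : List Edge
    edges = walkEdges steps
    value : Carrier
    value = walkValue steps

  open Cycle

  EdgeSetOf : List Edge → Subset nEdges → Set
  EdgeSetOf es X = ∀ e → (e ∈ₛ X) ⇔ (e ∈ es)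

  record TightHandcuff : Set where
    field
      C₁ C₂       : Cycle
      edgeDisj    : ∀ e → e ∈ edges C₁ → e ∉ edges C₂
      shared      : Fin n
      shared∈₁    : shared ∈ vertices C₁
      shared∈₂    : shared ∈ vertices C₂
      onlyShared  : ∀ x → x ∈ vertices C₁ → x ∈ vertices C₂ → x ≡ shared
    allEdges : List Edge
    allEdges = edges C₁ ++ edges C₂

  record LooseHandcuff : Set where
    field
      C₁ C₂     : Cycle
      vertDisj  : ∀ x → x ∈ vertices C₁ → x ∉ vertices C₂
      u w       : Fin n
      u∈        : u ∈ vertices C₁
      w∈        : w ∈ vertices C₂
      P         : Path u w
      meets₁    : ∀ x → x ∈ walkVertices u (Path.steps P) → x ∈ vertices C₁ → x ≡ u
      meets₂    : ∀ x → x ∈ walkVertices u (Path.steps P) → x ∈ vertices C₂ → x ≡ w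
    allEdges : List Edge
    allEdges = edges C₁ ++ edges C₂ ++ walkEdges (Path.steps P)

  record Theta : Set where
    field
      u v        : Fin n
      u≢v        : u ≢ v
      P₁ P₂ P₃   : Path u v
      intDisj₁₂ : ∀ x → x ∈ walkVertices u (Path.steps P₁) → x ∈ walkVertices u (Path.steps P₂) → (x ≡ u) ⊎ (x ≡ v)
      intDisj₁₃ : ∀ x → x ∈ walkVertices u (Path.steps P₁) → x ∈ walkVertices u (Path.steps P₃) → (x ≡ u) ⊎ (x ≡ v)
      intDisj₂₃ : ∀ x → x ∈ walkVertices u (Path.steps P₂) → x ∈ walkVertices u (Path.steps P₃) → (x ≡ u) ⊎ (x ≡ v)
      edgeDisj₁₂ : ∀ e → e ∈ walkEdges (Path.steps P₁) → e ∉ walkEdges (Path.steps P₂)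
      edgeDisj₁₃ : ∀ e → e ∈ walkEdges (Path.steps P₁) → e ∉ walkEdges (Path.steps P₃)
      edgeDisj₂₃ : ∀ e → e ∈ walkEdges (Path.steps P₂) → e ∉ walkEdges (Path.steps P₃)
    s₁ s₂ s₃ : List Step
    s₁ = Path.steps P₁
    s₂ = Path.steps P₂
    s₃ = Path.steps P₃
    allEdges : List Edge
    allEdges = walkEdges s₁ ++ walkEdges s₂ ++ walkEdges s₃
    value₁₂ value₁₃ value₂₃ : Carrier
    value₁₂ = walkValue (s₁ ++ reverseWalk s₂)
    value₁₃ = walkValue (s₁ ++ reverseWalk s₃)
    value₂₃ = walkValue (s₂ ++ reverseWalk s₃)

  -- circuits of the frame matroid F(K_n^Γ, ψ_n^Γ / H) for a normal subgroup H:
  -- a cycle is (ψ/H)-balanced iff the gain of a closed walk around it lies in H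
  FrameCircuit : GSubset → Subset nEdges → Set
  FrameCircuit H X =
      (Σ Cycle λ C → EdgeSetOf (edges C) X × value C ∈Γ H)
    ⊎ (Σ TightHandcuff λ h → EdgeSetOf (TightHandcuff.allEdges h) X
         × value (TightHandcuff.C₁ h) ∉Γ H × value (TightHandcuff.C₂ h) ∉Γ H)
    ⊎ (Σ LooseHandcuff λ h → EdgeSetOf (LooseHandcuff.allEdges h) X
         × value (LooseHandcuff.C₁ h) ∉Γ H × value (LooseHandcuff.C₂ h) ∉Γ H)
    ⊎ (Σ Theta λ t → EdgeSetOf (Theta.allEdges t) X
         × Theta.value₁₂ t ∉Γ H × Theta.value₁₃ t ∉Γ H × Theta.value₂₃ t ∉Γ H)

  IsFrameMatroid : GSubset → Matroid nEdges → Set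
  IsFrameMatroid H N = ∀ X → IsCircuit N X ⇔ FrameCircuit H X

  HandcuffOrTheta : Subset nEdges → Set
  HandcuffOrTheta X =
      (Σ TightHandcuff λ h → EdgeSetOf (TightHandcuff.allEdges h) X)
    ⊎ (Σ LooseHandcuff λ h → EdgeSetOf (LooseHandcuff.allEdges h) X)
    ⊎ (Σ Theta λ t → EdgeSetOf (Theta.allEdges t) X)

  -- the set 𝒞(Γ, Γ₁, 𝒜, K_n^Γ, ψ_n^Γ), where N = F(K_n^Γ, ψ_n^Γ/Γ₁)
  InCircuitClass : List GSubset → Matroid nEdges → Subset nEdges → Set
  InCircuitClass 𝒜 N C =
    IsCircuit N C ×
    ( (Σ Cycle λ W → EdgeSetOf (edges W) C × value W ≡ ε)
    ⊎ (HandcuffOrTheta C ×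
        ∃[ η ] ∃[ A ] (A ∈ 𝒜 × (∀ e → e ∈ₛ C → ∀ d → ψ^ η (e , d) ∈Γ A))))

  -- M = M(Γ, Γ₁, 𝒜, K_n^Γ, ψ_n^Γ), where N = F(K_n^Γ, ψ_n^Γ/Γ₁)
  IsMConstruction : List GSubset → Matroid nEdges → Matroid nEdges → Set
  IsMConstruction 𝒜 N M =
    ∀ X → let Good = ∀ C → C ⊆ X → IsCircuit N C → InCircuitClass 𝒜 N C in
          (Good → rank M X ≡ rank N X) × (¬ Good → rank M X ≡ suc (rank N X))

{-# OPTIONS --safe #-}

-- Call X unlifted if its ranks in M and N agree. Subsets of unlifted sets are unlifted, and
-- X is unlifted as soon as every N-circuit in X is an M-circuit; so it suffices to determine which
-- N-circuits are M-circuits.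
--
-- Fix a switching η and α ∉ Γ₁. The M-closure F of a spanning path of η-gain ε and one edge of gain
-- α is unlifted, because its generators form a proper subset of a loose handcuff that is an N-circuit.
-- Balanced triangles are M-circuits, so the set of gains occurring in F is the same for all pairs of
-- vertices and is a subgroup A, and it meets Γ₁ trivially. Exchange in a loose handcuff shows that
-- every γ ∈ A outside Γ₁ generates the same F, so these subgroups and Γ₁ partition Γ. A theta
-- graph of three parallel edges shows that A depends only on the values of η at two vertices, hence
-- (as n ≥ 4) not on η. Constant switchings now give closure under conjugation, and switching
-- two of four vertices gives malnormality. Finally, a handcuff or theta graph is a tree with two
-- further edges, so after switching the tree to ε it is an M-circuit exactly if it lies in some F.

module Submission where

open import Defs
open import Algebra.Bundles using (Group)
import Algebra.Properties.Group as GroupProperties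
open import Data.Nat using (ℕ; zero; suc; _+_; _≤_; _<_; _<ᵇ_; z≤n; s≤s; s≤s⁻¹; _≤?_)
open import Data.Nat.Properties hiding (_≟_)
open import Data.Bool using (true; false; if_then_else_; T)
open import Data.Empty using () renaming (⊥ to Empty)
open import Data.Fin using (Fin; toℕ; _≟_)
open import Data.Fin.Properties using (any?; toℕ-injective)
open import Data.Fin.Subset using (Subset; inside; outside; ⊥; ⁅_⁆; _∪_; _∩_; _-_; ∣_∣; _⊆_; _⊂_)
  renaming (_∈_ to _∈ₛ_)
open import Data.Fin.Subset.Properties
open import Data.List using (List; []; _∷_; map; concatMap; foldr; _++_; allFin; lookup)
open import Data.List.Membership.DecPropositional using () renaming (_∈?_ to mem?)
open import Data.List.Membership.Propositional using (_∈_; _∉_; find; lose)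
open import Data.List.Membership.Propositional.Properties
open import Data.List.Properties using (unfold-reverse)
open import Data.List.Relation.Unary.All using (All; []; _∷_)
import Data.List.Relation.Unary.All as All
import Data.List.Relation.Unary.All.Properties as Allₚ
open import Data.List.Relation.Unary.AllPairs using ([]; _∷_)
import Data.List.Relation.Unary.AllPairs as AllPairs
open import Data.List.Relation.Unary.Any using (here; there; index)
open import Data.List.Relation.Unary.Any.Properties using (lookup-index; reverse⁻)
open import Data.List.Relation.Unary.Unique.Propositional using (Unique)
import Data.List.Relation.Unary.Unique.Propositional.Properties as Unique
open import Data.Product using (Σ; ∃-syntax; _×_; _,_; proj₁; proj₂)
open import Data.Sum using (_⊎_; inj₁; inj₂; [_,_]′)
open import Data.Vec using (_∷_; here; there; tabulate)
open import Data.Vec.Properties using ([]=⇒lookup; lookup⇒[]=; lookup∘tabulate)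
open import Function using (_∘_; id)
open import Function.Bundles using (_⇔_; mk⇔; Equivalence; Inverse)
open import Relation.Binary.Definitions using (tri<; tri≈; tri>; DecidableEquality)
open import Relation.Nullary using (¬_; Dec; yes; no; contradiction)
open import Relation.Nullary.Decidable using (_×-dec_; ¬?; map′; does; dec-true)
open import Relation.Binary.PropositionalEquality
  using (_≡_; _≢_; refl; sym; trans; cong; cong₂; subst; subst₂; module ≡-Reasoning)

-- Rank, circuits and closure in a matroid

∣p∣≤1+∣p-x∣ : ∀ {m} (p : Subset m) x → ∣ p ∣ ≤ suc ∣ p - x ∣
∣p∣≤1+∣p-x∣ (inside  ∷ p) Fin.zero    = s≤s (≤-reflexive (cong ∣_∣ (sym (p─⊥≡p p))))
∣p∣≤1+∣p-x∣ (outside ∷ p) Fin.zero    = m≤n⇒m≤1+n (≤-reflexive (cong ∣_∣ (sym (p─⊥≡p p))))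
∣p∣≤1+∣p-x∣ (inside  ∷ p) (Fin.suc x) = s≤s (∣p∣≤1+∣p-x∣ p x)
∣p∣≤1+∣p-x∣ (outside ∷ p) (Fin.suc x) = ∣p∣≤1+∣p-x∣ p x

x∈p-y⇒x∈p : ∀ {m} {p : Subset m} {x y} → x ∈ₛ p - y → x ∈ₛ p
x∈p-y⇒x∈p {p = p} {y = y} = p─q⊆p p ⁅ y ⁆

x∉p-x : ∀ {m} (p : Subset m) x → ¬ (x ∈ₛ p - x)
x∉p-x (inside  ∷ p) Fin.zero    ()
x∉p-x (outside ∷ p) Fin.zero    ()
x∉p-x (_ ∷ p) (Fin.suc x) (there x∈) = x∉p-x p x x∈

module _ {m : ℕ} (M : Matroid m) where

  Independent : Subset m → Set
  Independent X = rank M X ≡ ∣ X ∣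

  -- Monotonicity relaxes submodularity to subsets of the union and of the intersection, so that
  -- applications need inclusions rather than set identities.
  rank-submod-⊆ : ∀ {X Y} U I → U ⊆ X ∪ Y → I ⊆ X ∩ Y → rank M U + rank M I ≤ rank M X + rank M Y
  rank-submod-⊆ {X} {Y} U I U⊆ I⊆ =
    ≤-trans (+-mono-≤ (rank-mono M U⊆) (rank-mono M I⊆)) (rank-submod M X Y)

  rank≤1+rank- : ∀ X x → rank M X ≤ suc (rank M (X - x))
  rank≤1+rank- X x = begin
    rank M X                       ≤⟨ m≤m+n _ _ ⟩
    rank M X + rank M ⊥            ≤⟨ rank-submod-⊆ X ⊥ X⊆ ⊥⊆ ⟩
    rank M (X - x) + rank M ⁅ x ⁆  ≤⟨ +-monoʳ-≤ _ (≤-trans (rank-bound M ⁅ x ⁆) (≤-reflexive (∣⁅x⁆∣≡1 x))) ⟩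
    rank M (X - x) + 1             ≡⟨ +-comm _ 1 ⟩
    suc (rank M (X - x))           ∎
    where
    open ≤-Reasoning
    X⊆ : X ⊆ (X - x) ∪ ⁅ x ⁆
    X⊆ {y} y∈ with y ≟ x
    ... | yes refl = x∈p∪q⁺ (inj₂ (x∈⁅x⁆ x))
    ... | no y≢x   = x∈p∪q⁺ (inj₁ (x∈p∧x≢y⇒x∈p-y y∈ y≢x))

  independent-- : ∀ {X x} → x ∈ₛ X → Independent X → Independent (X - x)
  independent-- {X} {x} x∈X indep = ≤-antisym (rank-bound M _) (s≤s⁻¹ (begin
    suc ∣ X - x ∣          ≤⟨ x∈p⇒∣p-x∣<∣p∣ x∈X ⟩
    ∣ X ∣                  ≡⟨ sym indep ⟩
    rank M X               ≤⟨ rank≤1+rank- X x ⟩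
    suc (rank M (X - x))   ∎))
    where open ≤-Reasoning

  independent-⊆ : ∀ {X Y} → Y ⊆ X → Independent X → Independent Y
  independent-⊆ {X} = go ∣ X ∣ X ≤-refl
    where
    -- `k` bounds the size of `X` and carries the recursion, because `X - x` is not structurally
    -- smaller. The later inductions on sets use the same device.
    go : ∀ k X {Y} → ∣ X ∣ ≤ k → Y ⊆ X → Independent X → Independent Y
    go k X {Y} ≤k Y⊆X indep with any? (λ x → (x ∈? X) ×-dec (¬? (x ∈? Y)))
    go k X {Y} ≤k Y⊆X indep | no none = subst Independent (⊆-antisym X⊆Y Y⊆X) indep
      where
      X⊆Y : X ⊆ Y
      X⊆Y {x} x∈X with x ∈? Y
      ... | yes x∈Y = x∈Y
      ... | no  x∉Y = contradiction (x , x∈X , x∉Y) none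
    go zero X ≤k Y⊆X indep | yes (x , x∈X , x∉Y) = contradiction (≤-trans (x∈p⇒∣p-x∣<∣p∣ x∈X) ≤k) λ ()
    go (suc k) X ≤k Y⊆X indep | yes (x , x∈X , x∉Y) =
      go k (X - x) (s≤s⁻¹ (≤-trans (x∈p⇒∣p-x∣<∣p∣ x∈X) ≤k))
         (λ {y} y∈Y → x∈p∧x≢y⇒x∈p-y (Y⊆X y∈Y) λ { refl → x∉Y y∈Y }) (independent-- x∈X indep)

  -- Elements are deleted as long as the set stays dependent. Once every `X - x` is independent, so
  -- is every proper subset.
  dependent⇒circuit : ∀ X → rank M X < ∣ X ∣ → ∃[ C ] (C ⊆ X × IsCircuit M C)
  dependent⇒circuit X = go ∣ X ∣ X ≤-refl
    where
    go : ∀ k X → ∣ X ∣ ≤ k → rank M X < ∣ X ∣ → ∃[ C ] (C ⊆ X × IsCircuit M C)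
    go k X ≤k dep with any? (λ x → (x ∈? X) ×-dec (rank M (X - x) <? ∣ X - x ∣))
    go zero X ≤k dep | yes _ = contradiction (≤-trans dep ≤k) λ ()
    go (suc k) X ≤k dep | yes (x , x∈X , dep′) with go k (X - x) (s≤s⁻¹ (≤-trans (x∈p⇒∣p-x∣<∣p∣ x∈X) ≤k)) dep′
    ... | C , C⊆ , circ = C , (λ y∈ → x∈p-y⇒x∈p {p = X} {y = x} (C⊆ y∈)) , circ
    go k X ≤k dep | no none = X , id , dep , λ Y (Y⊆X , x , x∈X , x∉Y) →
      independent-⊆ (λ {y} y∈Y → x∈p∧x≢y⇒x∈p-y (Y⊆X y∈Y) λ { refl → x∉Y y∈Y })
        (≤-antisym (rank-bound M (X - x)) (≮⇒≥ λ dep′ → none (x , x∈X , dep′)))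

  -- Membership of `x` in the closure of `S`. The reverse inequality is monotonicity, and a
  -- comparison of ranks is decidable, which later allows labels to be collected into a subset.
  Spans : Subset m → Fin m → Set
  Spans S x = rank M (S ∪ ⁅ x ⁆) ≤ rank M S

  spans? : ∀ S x → Dec (Spans S x)
  spans? S x = rank M (S ∪ ⁅ x ⁆) ≤? rank M S

  ∈⇒spans : ∀ {S x} → x ∈ₛ S → Spans S x
  ∈⇒spans {S} {x} x∈S = rank-mono M (λ y∈ → [ id , (λ y∈x → subst (_∈ₛ S) (sym (x∈⁅y⁆⇒x≡y x y∈x)) x∈S) ]′ (x∈p∪q⁻ S ⁅ x ⁆ y∈))

  -- Induction on the size of `C`: by submodularity, `S ∪ (C - x)` and `S ∪ ⁅ x ⁆`, both of rank at
  -- most that of `S` and both containing `S`, have a union of rank at most that of `S`.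
  spans-all : ∀ {S} C → (∀ {x} → x ∈ₛ C → Spans S x) → rank M (S ∪ C) ≤ rank M S
  spans-all {S} C = go ∣ C ∣ C ≤-refl
    where
    go : ∀ k C → ∣ C ∣ ≤ k → (∀ {x} → x ∈ₛ C → Spans S x) → rank M (S ∪ C) ≤ rank M S
    go k C ≤k sp with nonempty? C
    go k C ≤k sp | no empty =
      rank-mono M (λ {y} y∈ → [ id , (λ y∈C → contradiction (y , y∈C) empty) ]′ (x∈p∪q⁻ S C y∈))
    go zero C ≤k sp | yes (x , x∈C) = contradiction (≤-trans (x∈p⇒∣p-x∣<∣p∣ x∈C) ≤k) λ ()
    go (suc k) C ≤k sp | yes (x , x∈C) = +-cancelʳ-≤ (rank M S) _ _ (begin
      rank M (S ∪ C) + rank M S                    ≤⟨ rank-submod-⊆ (S ∪ C) S U⊆ (λ y∈ → x∈p∩q⁺ (x∈p∪q⁺ (inj₁ y∈) , x∈p∪q⁺ (inj₁ y∈))) ⟩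
      rank M (S ∪ (C - x)) + rank M (S ∪ ⁅ x ⁆)    ≤⟨ +-mono-≤ (go k (C - x) (s≤s⁻¹ (≤-trans (x∈p⇒∣p-x∣<∣p∣ x∈C) ≤k))
                                                                    (λ y∈ → sp (x∈p-y⇒x∈p {p = C} {y = x} y∈))) (sp x∈C) ⟩
      rank M S + rank M S                          ∎)
      where
      open ≤-Reasoning
      U⊆ : S ∪ C ⊆ (S ∪ (C - x)) ∪ (S ∪ ⁅ x ⁆)
      U⊆ {y} y∈ with x∈p∪q⁻ S C y∈
      ... | inj₁ y∈S = x∈p∪q⁺ (inj₁ (x∈p∪q⁺ (inj₁ y∈S)))
      ... | inj₂ y∈C with y ≟ x
      ...   | yes refl = x∈p∪q⁺ (inj₂ (x∈p∪q⁺ (inj₂ (x∈⁅x⁆ x))))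
      ...   | no y≢x   = x∈p∪q⁺ (inj₁ (x∈p∪q⁺ (inj₂ (x∈p∧x≢y⇒x∈p-y y∈C y≢x))))

  circuit-rank- : ∀ {D x} → IsCircuit M D → x ∈ₛ D → rank M D ≤ rank M (D - x)
  circuit-rank- {D} {x} (dep , indep) x∈D = s≤s⁻¹ (begin
    suc (rank M D)         ≤⟨ dep ⟩
    ∣ D ∣                  ≤⟨ ∣p∣≤1+∣p-x∣ D x ⟩
    suc ∣ D - x ∣          ≡⟨ cong suc (sym (indep (D - x) (x∈p⇒p-x⊂p x∈D))) ⟩
    suc (rank M (D - x))   ∎)
    where open ≤-Reasoning

  -- Removing `x` does not lower the rank of the circuit `D`, so submodularity for `S ∪ (D - x)` and
  -- `D`, which share `D - x`, shows that adding `x` to `S` costs no rank.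
  circuit-spans : ∀ {S D x} → IsCircuit M D → x ∈ₛ D → (∀ {y} → y ∈ₛ D → y ≢ x → Spans S y) → Spans S x
  circuit-spans {S} {D} {x} circ x∈D sp = +-cancelʳ-≤ (rank M D) _ _ (begin
    rank M (S ∪ ⁅ x ⁆) + rank M D          ≤⟨ +-monoʳ-≤ _ (circuit-rank- circ x∈D) ⟩
    rank M (S ∪ ⁅ x ⁆) + rank M (D - x)    ≤⟨ rank-submod-⊆ (S ∪ ⁅ x ⁆) (D - x) U⊆ I⊆ ⟩
    rank M (S ∪ (D - x)) + rank M D        ≤⟨ +-monoˡ-≤ _ (spans-all (D - x) λ y∈ → sp (x∈p-y⇒x∈p {p = D} {y = x} y∈) λ { refl → x∉p-x D x y∈ }) ⟩
    rank M S + rank M D                    ∎)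
    where
    open ≤-Reasoning
    U⊆ : S ∪ ⁅ x ⁆ ⊆ (S ∪ (D - x)) ∪ D
    U⊆ {y} y∈ with x∈p∪q⁻ S ⁅ x ⁆ y∈
    ... | inj₁ y∈S = x∈p∪q⁺ (inj₁ (x∈p∪q⁺ (inj₁ y∈S)))
    ... | inj₂ y∈x = x∈p∪q⁺ (inj₂ (subst (_∈ₛ D) (sym (x∈⁅y⁆⇒x≡y x y∈x)) x∈D))
    I⊆ : D - x ⊆ (S ∪ (D - x)) ∩ D
    I⊆ y∈ = x∈p∩q⁺ (x∈p∪q⁺ (inj₂ y∈) , x∈p-y⇒x∈p {p = D} {y = x} y∈)

  -- Submodularity for `S ∪ B` and `B ∪ ⁅ x ⁆`, whose intersection contains `B`.
  spans-trans : ∀ {S B x} → (∀ {y} → y ∈ₛ B → Spans S y) → Spans B x → Spans S x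
  spans-trans {S} {B} {x} B⊆ sp = +-cancelʳ-≤ (rank M B) _ _ (begin
    rank M (S ∪ ⁅ x ⁆) + rank M B          ≤⟨ rank-submod-⊆ (S ∪ ⁅ x ⁆) B U⊆ (λ y∈ → x∈p∩q⁺ (x∈p∪q⁺ (inj₂ y∈) , x∈p∪q⁺ (inj₁ y∈))) ⟩
    rank M (S ∪ B) + rank M (B ∪ ⁅ x ⁆)    ≤⟨ +-mono-≤ (spans-all B B⊆) sp ⟩
    rank M S + rank M B                    ∎)
    where
    open ≤-Reasoning
    U⊆ : S ∪ ⁅ x ⁆ ⊆ (S ∪ B) ∪ (B ∪ ⁅ x ⁆)
    U⊆ y∈ = [ (λ y∈S → x∈p∪q⁺ (inj₁ (x∈p∪q⁺ (inj₁ y∈S)))) , (λ y∈x → x∈p∪q⁺ (inj₂ (x∈p∪q⁺ (inj₂ y∈x)))) ]′ (x∈p∪q⁻ S ⁅ x ⁆ y∈)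

-- Elementary lifts

module ElementaryLift {m : ℕ} (N M : Matroid m) (lift : IsElementaryLift M N) where
  private
    K : Matroid (suc m)
    K = proj₁ lift
    M≡ : ∀ X → rank M X ≡ rank K (outside ∷ X)
    M≡ = proj₁ (proj₂ lift)
    -- The rank of the new element is kept as an unknown, 0 or 1, so that a loop is covered as well.
    k : ℕ
    k = rank K (inside ∷ ⊥)
    N≡ : ∀ X → rank K (inside ∷ X) ≡ rank N X + k
    N≡ = proj₂ (proj₂ lift)

    k≤1 : k ≤ 1
    k≤1 = ≤-trans (rank-bound K (inside ∷ ⊥)) (≤-reflexive (cong suc (∣⊥∣≡0 m)))

  N≤M : ∀ X → rank N X ≤ rank M X
  N≤M X = +-cancelʳ-≤ k _ _ (begin
    rank N X + k                              ≡⟨ sym (N≡ X) ⟩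
    rank K (inside ∷ X)                       ≤⟨ m≤m+n _ (rank K ⊥) ⟩
    rank K (inside ∷ X) + rank K ⊥            ≤⟨ rank-submod-⊆ K (inside ∷ X) ⊥ U⊆ ⊥⊆ ⟩
    rank K (outside ∷ X) + k                  ≡⟨ cong (_+ k) (sym (M≡ X)) ⟩
    rank M X + k                              ∎)
    where
    open ≤-Reasoning
    U⊆ : inside ∷ X ⊆ (outside ∷ X) ∪ (inside ∷ ⊥)
    U⊆ here       = here
    U⊆ (there x∈) = there (x∈p∪q⁺ (inj₁ x∈))

  M≤1+N : ∀ X → rank M X ≤ suc (rank N X)
  M≤1+N X = begin
    rank M X              ≡⟨ M≡ X ⟩
    rank K (outside ∷ X)  ≤⟨ rank-mono K (λ { (there x∈) → there x∈ }) ⟩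
    rank K (inside ∷ X)   ≡⟨ N≡ X ⟩
    rank N X + k          ≤⟨ +-monoʳ-≤ _ k≤1 ⟩
    rank N X + 1          ≡⟨ +-comm _ 1 ⟩
    suc (rank N X)        ∎
    where open ≤-Reasoning

  -- In K this says that the new element, when outside the closure of Y, is outside the closure of X.
  unlifted-⊆ : ∀ {X Y} → X ⊆ Y → rank M Y ≤ rank N Y → rank M X ≤ rank N X
  unlifted-⊆ {X} {Y} X⊆Y tight = +-cancelˡ-≤ (rank N Y + k) _ _ (begin
    (rank N Y + k) + rank M X                    ≡⟨ cong₂ _+_ (sym (N≡ Y)) (M≡ X) ⟩
    rank K (inside ∷ Y) + rank K (outside ∷ X)   ≤⟨ rank-submod-⊆ K (inside ∷ Y) (outside ∷ X) U⊆ I⊆ ⟩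
    rank K (outside ∷ Y) + rank K (inside ∷ X)   ≡⟨ cong₂ _+_ (sym (M≡ Y)) (N≡ X) ⟩
    rank M Y + (rank N X + k)                    ≤⟨ +-monoˡ-≤ _ tight ⟩
    rank N Y + (rank N X + k)                    ≡⟨ cong (rank N Y +_) (+-comm (rank N X) k) ⟩
    rank N Y + (k + rank N X)                    ≡⟨ sym (+-assoc (rank N Y) k (rank N X)) ⟩
    (rank N Y + k) + rank N X                    ∎)
    where
    open ≤-Reasoning
    U⊆ : inside ∷ Y ⊆ (outside ∷ Y) ∪ (inside ∷ X)
    U⊆ here       = here
    U⊆ (there y∈) = there (x∈p∪q⁺ (inj₁ y∈))
    I⊆ : outside ∷ X ⊆ (outside ∷ Y) ∩ (inside ∷ X)
    I⊆ (there x∈) = there (x∈p∩q⁺ (X⊆Y x∈ , x∈))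

  -- If `X` is independent in `N`, its size bounds both ranks. Otherwise an element `x` of an
  -- `N`-circuit in `X` is deleted: that circuit is also an `M`-circuit, so the rank in `M` does not
  -- drop, and induction applies to `X - x`.
  circuits⇒unlifted : ∀ {X} → (∀ D → D ⊆ X → IsCircuit N D → IsCircuit M D) → rank M X ≤ rank N X
  circuits⇒unlifted {X} good = go ∣ X ∣ X ≤-refl good
    where
    open ≤-Reasoning
    go : ∀ j X → ∣ X ∣ ≤ j → (∀ D → D ⊆ X → IsCircuit N D → IsCircuit M D) → rank M X ≤ rank N X
    go j X ≤j good with rank N X <? ∣ X ∣
    ... | no indep = ≤-trans (rank-bound M X) (≮⇒≥ indep)
    ... | yes dep with dependent⇒circuit N X dep
    go j X ≤j good | yes dep | C , C⊆X , circ with nonempty? C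
    ... | no empty = contradiction (≤-trans (proj₁ circ) (≤-reflexive (trans (cong ∣_∣ (Empty-unique empty)) (∣⊥∣≡0 m)))) λ ()
    go zero X ≤j good | yes dep | C , C⊆X , circ | yes (x , x∈C) =
      contradiction (≤-trans dep ≤j) λ ()
    go (suc j) X ≤j good | yes dep | C , C⊆X , circ | yes (x , x∈C) = begin
      rank M X                    ≤⟨ rank-mono M X⊆ ⟩
      rank M ((X - x) ∪ ⁅ x ⁆)    ≤⟨ circuit-spans M (good C C⊆X circ) x∈C (λ y∈C y≢x → ∈⇒spans M (x∈p∧x≢y⇒x∈p-y (C⊆X y∈C) y≢x)) ⟩
      rank M (X - x)              ≤⟨ go j (X - x) (s≤s⁻¹ (≤-trans (x∈p⇒∣p-x∣<∣p∣ (C⊆X x∈C)) ≤j))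
                                     (λ D D⊆ → good D (λ y∈ → x∈p-y⇒x∈p {p = X} {y = x} (D⊆ y∈))) ⟩
      rank N (X - x)              ≤⟨ rank-mono N (x∈p-y⇒x∈p {p = X} {y = x}) ⟩
      rank N X                    ∎
      where
      X⊆ : X ⊆ (X - x) ∪ ⁅ x ⁆
      X⊆ {y} y∈ with y ≟ x
      ... | yes refl = x∈p∪q⁺ (inj₂ (x∈⁅x⁆ x))
      ... | no y≢x   = x∈p∪q⁺ (inj₁ (x∈p∧x≢y⇒x∈p-y y∈ y≢x))

  unlifted-circuit : ∀ {C} → IsCircuit N C → rank M C ≤ rank N C → IsCircuit M C
  unlifted-circuit {C} (dep , indep) tight =
    ≤-<-trans tight dep ,
    λ Y Y⊂C → ≤-antisym (rank-bound M Y) (≤-trans (≤-reflexive (sym (indep Y Y⊂C))) (N≤M Y))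

  -- The rank of `S ∪ C` in `M` is at most the size of `S`, which is the rank of `S` in `N`. Hence
  -- `S ∪ C` is unlifted, and with it `C`.
  spanned-circuit : ∀ {S C} → Independent N S → IsCircuit N C → (∀ {x} → x ∈ₛ C → Spans M S x) → IsCircuit M C
  spanned-circuit {S} {C} indep circ sp = unlifted-circuit circ (unlifted-⊆ (q⊆p∪q S C) (begin
    rank M (S ∪ C)  ≤⟨ spans-all M C sp ⟩
    rank M S        ≤⟨ rank-bound M S ⟩
    ∣ S ∣           ≡⟨ sym indep ⟩
    rank N S        ≤⟨ rank-mono N (p⊆p∪q C) ⟩
    rank N (S ∪ C)  ∎))
    where open ≤-Reasoning

-- Gain graphs

⟦_⟧ : ∀ {m} → List (Fin m) → Subset m
⟦ es ⟧ = foldr (λ e X → ⁅ e ⁆ ∪ X) ⊥ es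

∈⟦⟧⁺ : ∀ {m} {e : Fin m} es → e ∈ es → e ∈ₛ ⟦ es ⟧
∈⟦⟧⁺ (_ ∷ _)  (here refl) = x∈p∪q⁺ (inj₁ (x∈⁅x⁆ _))
∈⟦⟧⁺ (_ ∷ es) (there e∈)  = x∈p∪q⁺ (inj₂ (∈⟦⟧⁺ es e∈))

∈⟦⟧⁻ : ∀ {m} {e : Fin m} es → e ∈ₛ ⟦ es ⟧ → e ∈ es
∈⟦⟧⁻ [] e∈ = contradiction e∈ ∉⊥
∈⟦⟧⁻ (f ∷ es) e∈ with x∈p∪q⁻ ⁅ f ⁆ ⟦ es ⟧ e∈
... | inj₁ e∈f = here (x∈⁅y⁆⇒x≡y f e∈f)
... | inj₂ e∈  = there (∈⟦⟧⁻ es e∈)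

module GroupFacts (Γ : FiniteGroup) where
  open FiniteGroup Γ public

  group : Group _ _
  group = record { isGroup = isGroup }

  open Group group public using (assoc; identityˡ; identityʳ; inverseˡ; inverseʳ)
  open GroupProperties group public
    using (⁻¹-involutive; ⁻¹-anti-homo-∙; ε⁻¹≈ε; x∙y⁻¹≈ε⇒x≈y;
           \\-leftDividesˡ; \\-leftDividesʳ; //-rightDividesˡ; //-rightDividesʳ)

  decode-code : ∀ x → decode (code x) ≡ x
  decode-code = Inverse.strictlyInverseʳ enumeration

  infix 4 _≟Γ_
  _≟Γ_ : DecidableEquality Carrier
  x ≟Γ y = map′ (λ eq → trans (sym (decode-code x)) (trans (cong decode eq) (decode-code y))) (cong code) (code x ≟ code y)

  _∈Γ?_ : ∀ x S → Dec (x ∈Γ S)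
  x ∈Γ? S = code x ∈? S

  ∈-elements : ∀ x → x ∈ elements
  ∈-elements x = subst (_∈ elements) (decode-code x) (∈-map⁺ decode (∈-allFin (code x)))

  -- The factors `b` and `b ⁻¹` cancel in the middle. This is why switched gains telescope along a
  -- walk.
  conj-split : ∀ a x b y c → a ⁻¹ ∙ (x ∙ y) ∙ c ≡ (a ⁻¹ ∙ x ∙ b) ∙ (b ⁻¹ ∙ y ∙ c)
  conj-split a x b y c = sym (begin
    (a ⁻¹ ∙ x ∙ b) ∙ (b ⁻¹ ∙ y ∙ c)     ≡⟨ assoc (a ⁻¹ ∙ x) b _ ⟩
    a ⁻¹ ∙ x ∙ (b ∙ (b ⁻¹ ∙ y ∙ c))     ≡⟨ cong (λ z → a ⁻¹ ∙ x ∙ (b ∙ z)) (assoc (b ⁻¹) y c) ⟩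
    a ⁻¹ ∙ x ∙ (b ∙ (b ⁻¹ ∙ (y ∙ c)))   ≡⟨ cong (a ⁻¹ ∙ x ∙_) (\\-leftDividesˡ b (y ∙ c)) ⟩
    a ⁻¹ ∙ x ∙ (y ∙ c)                  ≡⟨ sym (assoc (a ⁻¹ ∙ x) y c) ⟩
    a ⁻¹ ∙ x ∙ y ∙ c                    ≡⟨ cong (_∙ c) (assoc (a ⁻¹) x y) ⟩
    a ⁻¹ ∙ (x ∙ y) ∙ c                  ∎)
    where open ≡-Reasoning

  conj-⁻¹ : ∀ a x b → (a ⁻¹ ∙ x ∙ b) ⁻¹ ≡ b ⁻¹ ∙ x ⁻¹ ∙ a
  conj-⁻¹ a x b = begin
    (a ⁻¹ ∙ x ∙ b) ⁻¹          ≡⟨ ⁻¹-anti-homo-∙ (a ⁻¹ ∙ x) b ⟩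
    b ⁻¹ ∙ (a ⁻¹ ∙ x) ⁻¹       ≡⟨ cong (b ⁻¹ ∙_) (⁻¹-anti-homo-∙ (a ⁻¹) x) ⟩
    b ⁻¹ ∙ (x ⁻¹ ∙ a ⁻¹ ⁻¹)    ≡⟨ cong (λ z → b ⁻¹ ∙ (x ⁻¹ ∙ z)) (⁻¹-involutive a) ⟩
    b ⁻¹ ∙ (x ⁻¹ ∙ a)          ≡⟨ sym (assoc (b ⁻¹) (x ⁻¹) a) ⟩
    b ⁻¹ ∙ x ⁻¹ ∙ a            ∎
    where open ≡-Reasoning

  conj-ε : ∀ a → a ⁻¹ ∙ ε ∙ a ≡ ε
  conj-ε a = trans (cong (_∙ a) (identityʳ (a ⁻¹))) (inverseˡ a)

  -- With switching values `a` and `b` at the ends, `a ∙ g ∙ b ⁻¹` is the original gain that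
  -- switching turns into `g`.
  conj-cancel : ∀ a g b → a ⁻¹ ∙ (a ∙ g ∙ b ⁻¹) ∙ b ≡ g
  conj-cancel a g b = begin
    a ⁻¹ ∙ (a ∙ g ∙ b ⁻¹) ∙ b     ≡⟨ cong (_∙ b) (sym (assoc (a ⁻¹) (a ∙ g) (b ⁻¹))) ⟩
    a ⁻¹ ∙ (a ∙ g) ∙ b ⁻¹ ∙ b     ≡⟨ //-rightDividesˡ b _ ⟩
    a ⁻¹ ∙ (a ∙ g)                ≡⟨ \\-leftDividesʳ a g ⟩
    g                             ∎
    where open ≡-Reasoning

  conj-cancel′ : ∀ a g b → a ∙ (a ⁻¹ ∙ g ∙ b) ∙ b ⁻¹ ≡ g
  conj-cancel′ a g b = begin
    a ∙ (a ⁻¹ ∙ g ∙ b) ∙ b ⁻¹     ≡⟨ cong (_∙ b ⁻¹) (sym (assoc a (a ⁻¹ ∙ g) b)) ⟩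
    a ∙ (a ⁻¹ ∙ g) ∙ b ∙ b ⁻¹     ≡⟨ //-rightDividesʳ b _ ⟩
    a ∙ (a ⁻¹ ∙ g)                ≡⟨ \\-leftDividesˡ a g ⟩
    g                             ∎
    where open ≡-Reasoning

  ε-conjˡ : ∀ x → ε ⁻¹ ∙ x ∙ ε ≡ x
  ε-conjˡ x = trans (identityʳ _) (trans (cong (_∙ x) ε⁻¹≈ε) (identityˡ x))

  ε-conjʳ : ∀ x → ε ∙ x ∙ ε ⁻¹ ≡ x
  ε-conjʳ x = trans (cong (ε ∙ x ∙_) ε⁻¹≈ε) (trans (identityʳ _) (identityˡ x))

  normal-conj⁻ : ∀ {H} → IsNormalSubgroup Γ H → ∀ a g → a ⁻¹ ∙ g ∙ a ∈Γ H → g ∈Γ H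
  normal-conj⁻ {H} (_ , normal) a g g∈ =
    subst (_∈Γ H) (trans (cong (λ z → z ∙ (a ⁻¹ ∙ g ∙ a) ∙ a ⁻¹) (⁻¹-involutive a)) (conj-cancel′ a g a)) (normal (a ⁻¹) _ g∈)

module GainGraph (Γ : FiniteGroup) (n : ℕ) where
  open GroupFacts Γ public

  V E S : Set
  V = Fin n
  E = Edge Γ n
  S = Step Γ n

  tl hd : S → V
  tl = tailS Γ n
  hd = headS Γ n

  gain : (V → Carrier) → S → Carrier
  gain = ψ^ Γ n

  fl : S → S
  fl = flip Γ n

  private
    triples : List (V × V × Carrier)
    triples = edgeTriples Γ n

  triple∈ : ∀ {i j} α → toℕ i < toℕ j → (i , j , α) ∈ triples
  triple∈ {i} {j} α i<j =
    ∈-concatMap⁺ _ (lose (∈-allFin i) (∈-concatMap⁺ _ (lose (∈-allFin j) in-cell)))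
    where
    in-cell : (i , j , α) ∈ (if toℕ i <ᵇ toℕ j then map (λ α → (i , j , α)) elements else [])
    in-cell with toℕ i <ᵇ toℕ j | <⇒<ᵇ i<j
    ... | true | _ = ∈-map⁺ _ (∈-elements α)

  triple< : ∀ {i j α} → (i , j , α) ∈ triples → toℕ i < toℕ j
  triple< {i} {j} {α} t∈ with find (∈-concatMap⁻ _ {xs = allFin n} t∈)
  ... | i′ , _ , t∈row with find (∈-concatMap⁻ _ {xs = allFin n} t∈row)
  ... | j′ , _ , t∈cell = in-cell t∈cell
    where
    in-cell : (i , j , α) ∈ (if toℕ i′ <ᵇ toℕ j′ then map (λ α → (i′ , j′ , α)) elements else []) → toℕ i < toℕ j
    in-cell t∈ with toℕ i′ <ᵇ toℕ j′ in eq
    in-cell t∈ | true with ∈-map⁻ _ t∈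
    ... | _ , _ , refl = <ᵇ⇒< (toℕ i′) (toℕ j′) (subst T (sym eq) _)

  end< : ∀ e → toℕ (end₁ Γ n e) < toℕ (end₂ Γ n e)
  end< e = triple< (∈-lookup e)

  tl≢hd : ∀ s → tl s ≢ hd s
  tl≢hd (e , true)  eq = <-irrefl (cong toℕ eq) (end< e)
  tl≢hd (e , false) eq = <-irrefl (cong toℕ (sym eq)) (end< e)

  same-edge : ∀ s t → proj₁ s ≡ proj₁ t → (tl s ≡ tl t × hd s ≡ hd t × ψ Γ n s ≡ ψ Γ n t) ⊎ (tl s ≡ hd t × hd s ≡ tl t)
  same-edge (e , true)  (e , true)  refl = inj₁ (refl , refl , refl)
  same-edge (e , true)  (e , false) refl = inj₂ (refl , refl)
  same-edge (e , false) (e , true)  refl = inj₂ (refl , refl)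
  same-edge (e , false) (e , false) refl = inj₁ (refl , refl , refl)

  tl-fl : ∀ s → tl (fl s) ≡ hd s
  tl-fl (e , true)  = refl
  tl-fl (e , false) = refl

  hd-fl : ∀ s → hd (fl s) ≡ tl s
  hd-fl (e , true)  = refl
  hd-fl (e , false) = refl

  edge-fl : ∀ s → proj₁ (fl s) ≡ proj₁ s
  edge-fl (e , true)  = refl
  edge-fl (e , false) = refl

  ψ-fl : ∀ s → ψ Γ n (fl s) ≡ ψ Γ n s ⁻¹
  ψ-fl (e , true)  = refl
  ψ-fl (e , false) = sym (⁻¹-involutive _)

  gain-fl : ∀ η s → gain η (fl s) ≡ gain η s ⁻¹
  gain-fl η s = begin
    η (tl (fl s)) ⁻¹ ∙ ψ Γ n (fl s) ∙ η (hd (fl s))  ≡⟨ cong₂ _∙_ (cong₂ _∙_ (cong (λ v → η v ⁻¹) (tl-fl s)) (ψ-fl s)) (cong η (hd-fl s)) ⟩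
    η (hd s) ⁻¹ ∙ ψ Γ n s ⁻¹ ∙ η (tl s)              ≡⟨ sym (conj-⁻¹ _ _ _) ⟩
    gain η s ⁻¹                                      ∎
    where open ≡-Reasoning

  -- Indexing by ends and switched gain hides in which direction the edge is stored.
  record StepFrom (η : V → Carrier) (i j : V) (g : Carrier) : Set where
    constructor mkStep
    field
      step  : S
      tl≡   : tl step ≡ i
      hd≡   : hd step ≡ j
      gain≡ : gain η step ≡ g
    edge : E
    edge = proj₁ step

  open StepFrom public

  reverseStep : ∀ {η i j g} → StepFrom η i j g → StepFrom η j i (g ⁻¹)
  reverseStep {η} (mkStep s t h e) = mkStep (fl s) (trans (tl-fl s) h) (trans (hd-fl s) t) (trans (gain-fl η s) (cong _⁻¹ e))

  private
    upStep : ∀ {i j} → toℕ i < toℕ j → ∀ g → ∃[ s ] (tl s ≡ i × hd s ≡ j × ψ Γ n s ≡ g)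
    upStep {i} {j} i<j g = (index t∈ , true) , cong proj₁ t≡ , cong (proj₁ ∘ proj₂) t≡ , cong (proj₂ ∘ proj₂) t≡
      where
      t∈ = triple∈ {i} {j} g i<j
      t≡ = sym (lookup-index t∈)

    mkGain : ∀ η {i j} g s → tl s ≡ i → hd s ≡ j → ψ Γ n s ≡ η i ∙ g ∙ η j ⁻¹ → StepFrom η i j g
    mkGain η g s refl refl eq = mkStep s refl refl (trans (cong (λ z → η (tl s) ⁻¹ ∙ z ∙ η (hd s)) eq) (conj-cancel _ g _))

  abstract
    -- Edges are stored from the smaller end to the larger one, so for `j < i` the edge of inverse
    -- gain is flipped. Making it abstract keeps the comparison from unfolding in later types.
    stepFrom : ∀ η {i j} → i ≢ j → ∀ g → StepFrom η i j g
    stepFrom η {i} {j} i≢j g with <-cmp (toℕ i) (toℕ j)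
    ... | tri≈ _ i≡j _ = contradiction (toℕ-injective i≡j) i≢j
    ... | tri< i<j _ _ with upStep i<j (η i ∙ g ∙ η j ⁻¹)
    ...   | s , t , h , eq = mkGain η g s t h eq
    stepFrom η {i} {j} i≢j g | tri> _ _ j<i with upStep j<i ((η i ∙ g ∙ η j ⁻¹) ⁻¹)
    ...   | s , t , h , eq = mkGain η g (fl s) (trans (tl-fl s) h) (trans (hd-fl s) t)
                               (trans (ψ-fl s) (trans (cong _⁻¹ eq) (⁻¹-involutive _)))

  relabel : ∀ {η i j g h} → g ≡ h → StepFrom η i j g → StepFrom η i j h
  relabel eq s = mkStep (step s) (tl≡ s) (hd≡ s) (trans (gain≡ s) eq)

  reswitch : ∀ {η i j g} η′ → StepFrom η i j g → StepFrom η′ i j (η′ i ⁻¹ ∙ (η i ∙ g ∙ η j ⁻¹) ∙ η′ j)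
  reswitch {η} {i} {j} {g} η′ s = mkStep (step s) (tl≡ s) (hd≡ s) (gain-eq s)
    where
    gain-eq : (s : StepFrom η i j g) → gain η′ (step s) ≡ η′ i ⁻¹ ∙ (η i ∙ g ∙ η j ⁻¹) ∙ η′ j
    gain-eq (mkStep s refl refl refl) = cong (λ z → η′ (tl s) ⁻¹ ∙ z ∙ η′ (hd s)) (sym (conj-cancel′ (η (tl s)) (ψ Γ n s) (η (hd s))))

  StepFrom-ends≢ : ∀ {η i j g} → StepFrom η i j g → i ≢ j
  StepFrom-ends≢ (mkStep s refl refl _) = tl≢hd s

  stepOf : ∀ η s → StepFrom η (tl s) (hd s) (gain η s)
  stepOf η s = mkStep s refl refl refl

  edges≢-tail : ∀ {s t} → tl s ≢ tl t → tl s ≢ hd t → proj₁ s ≢ proj₁ t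
  edges≢-tail {s} {t} p q eq with same-edge s t eq
  ... | inj₁ (r , _) = p r
  ... | inj₂ (r , _) = q r

  edges≢-gain : ∀ {η i j g h} (s : StepFrom η i j g) (t : StepFrom η i j h) → g ≢ h → edge s ≢ edge t
  edges≢-gain {η} (mkStep s refl refl refl) (mkStep t t≡ h≡ refl) g≢h eq with same-edge s t eq
  ... | inj₁ (p , q , r) = g≢h (trans (cong (λ z → η (tl s) ⁻¹ ∙ z ∙ η (hd s)) r) (cong₂ (λ x y → η x ⁻¹ ∙ ψ Γ n t ∙ η y) p q))
  ... | inj₂ (p , _)     = tl≢hd s (trans p h≡)

  gainValue : (V → Carrier) → List S → Carrier
  gainValue η = foldr (λ s acc → gain η s ∙ acc) ε

  gainValue-walk : ∀ η {u v} ss → IsWalk Γ n u v ss → η u ⁻¹ ∙ walkValue Γ n ss ∙ η v ≡ gainValue η ss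
  gainValue-walk η {u} [] refl = conj-ε (η u)
  gainValue-walk η {v = v} (s ∷ ss) (refl , walk) =
    trans (conj-split (η (tl s)) (ψ Γ n s) (η (hd s)) (walkValue Γ n ss) (η v)) (cong (gain η s ∙_) (gainValue-walk η ss walk))

  gainValue-ε : ∀ η {u} ss → IsWalk Γ n u u ss → gainValue η ss ≡ ε → walkValue Γ n ss ≡ ε
  gainValue-ε η {u} ss walk eq = begin
    walkValue Γ n ss                                 ≡⟨ sym (conj-cancel′ (η u) _ (η u)) ⟩
    η u ∙ (η u ⁻¹ ∙ walkValue Γ n ss ∙ η u) ∙ η u ⁻¹ ≡⟨ cong (λ z → η u ∙ z ∙ η u ⁻¹) (trans (gainValue-walk η ss walk) eq) ⟩
    η u ∙ ε ∙ η u ⁻¹                                 ≡⟨ cong (_∙ η u ⁻¹) (identityʳ (η u)) ⟩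
    η u ∙ η u ⁻¹                                     ≡⟨ inverseʳ (η u) ⟩
    ε                                                ∎
    where open ≡-Reasoning

  -- Switching conjugates the gain of a closed walk by the value at its base point. As `H` is
  -- normal, balance modulo `H` can be tested after any switching.
  gainValue-normal : ∀ {H} → IsNormalSubgroup Γ H → ∀ η {u} ss → IsWalk Γ n u u ss →
                     gainValue η ss ∈Γ H ⇔ walkValue Γ n ss ∈Γ H
  gainValue-normal {H} normal η {u} ss walk = mk⇔
    (λ v∈ → normal-conj⁻ normal (η u) _ (subst (_∈Γ H) (sym (gainValue-walk η ss walk)) v∈))
    (λ v∈ → subst (_∈Γ H) (gainValue-walk η ss walk) (proj₂ normal (η u) _ v∈))

  edgeSet : ∀ es → EdgeSetOf Γ n es ⟦ es ⟧
  edgeSet es e = mk⇔ (∈⟦⟧⁻ es) (∈⟦⟧⁺ es)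

  digon : ∀ {η i j g h} (s : StepFrom η i j g) (t : StepFrom η i j h) → edge s ≢ edge t → Cycle Γ n
  digon {i = i} {j} s t s≢t = record
    { start     = i
    ; steps     = step s ∷ step (reverseStep t) ∷ []
    ; isWalk    = tl≡ s , trans (tl≡ (reverseStep t)) (sym (hd≡ s)) , hd≡ (reverseStep t)
    ; nonempty  = λ ()
    ; distinctV = ((λ eq → StepFrom-ends≢ s (trans (sym (tl≡ s)) (trans eq (tl≡ (reverseStep t))))) ∷ []) ∷ [] ∷ []
    ; distinctE = ((λ eq → s≢t (trans eq (edge-fl (step t)))) ∷ []) ∷ [] ∷ []
    }

  digon-gain : ∀ {η i j g h} (s : StepFrom η i j g) (t : StepFrom η i j h) (s≢t : edge s ≢ edge t) →
               gainValue η (Cycle.steps (digon s t s≢t)) ≡ g ∙ h ⁻¹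
  digon-gain s t _ = cong₂ _∙_ (gain≡ s) (trans (identityʳ _) (gain≡ (reverseStep t)))

  triangle : ∀ {η i j k g h f} → StepFrom η i j g → StepFrom η j k h → StepFrom η i k f → Cycle Γ n
  triangle {i = i} {j} {k} s t r = record
    { start     = i
    ; steps     = step s ∷ step t ∷ step r⁻ ∷ []
    ; isWalk    = tl≡ s , trans (tl≡ t) (sym (hd≡ s)) , trans (tl≡ r⁻) (sym (hd≡ t)) , hd≡ r⁻
    ; nonempty  = λ ()
    ; distinctV = (at (tl≡ s) (tl≡ t) i≢j ∷ at (tl≡ s) (tl≡ r⁻) i≢k ∷ []) ∷ (at (tl≡ t) (tl≡ r⁻) j≢k ∷ []) ∷ [] ∷ []
    ; distinctE =
        (edges≢-tail {step s} {step t} (at (tl≡ s) (tl≡ t) i≢j) (at (tl≡ s) (hd≡ t) i≢k)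
          -- The tail `i` of `s` is also an end of `r⁻`, so these two edges are told apart by the
          -- tail `k` of `r⁻`.
          ∷ edges≢-tail {step r⁻} {step s} (at (tl≡ r⁻) (tl≡ s) (i≢k ∘ sym)) (at (tl≡ r⁻) (hd≡ s) (j≢k ∘ sym)) ∘ sym ∷ [])
        ∷ (edges≢-tail {step t} {step r⁻} (at (tl≡ t) (tl≡ r⁻) j≢k) (at (tl≡ t) (hd≡ r⁻) (i≢j ∘ sym)) ∷ []) ∷ [] ∷ []
    }
    where
    r⁻ = reverseStep r
    i≢j = StepFrom-ends≢ s
    j≢k = StepFrom-ends≢ t
    i≢k = StepFrom-ends≢ r
    at : ∀ {x y x′ y′ : V} → x ≡ x′ → y ≡ y′ → x′ ≢ y′ → x ≢ y
    at refl refl p = p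

  triangle-gain : ∀ {η i j k g h f} (s : StepFrom η i j g) (t : StepFrom η j k h) (r : StepFrom η i k f) →
                  gainValue η (Cycle.steps (triangle s t r)) ≡ g ∙ (h ∙ f ⁻¹)
  triangle-gain s t r = cong₂ _∙_ (gain≡ s) (cong₂ _∙_ (gain≡ t) (trans (identityʳ _) (gain≡ (reverseStep r))))

-- Gains occurring in a flat

module FlatGains (Γ : FiniteGroup) (n : ℕ) (M : Matroid (nEdges Γ n))
  (balanced : ∀ (C : Cycle Γ n) X → EdgeSetOf Γ n (Cycle.edges C) X → IsCircuit M X ⇔ Cycle.value C ≡ FiniteGroup.ε Γ) where
  open GainGraph Γ n

  -- Flats in terms of circuits: no circuit has exactly one element outside. Predicates are used so
  -- that `Spans M S` is an instance as it stands.
  Flat : (E → Set) → Set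
  Flat F = ∀ {D x} → IsCircuit M D → x ∈ₛ D → (∀ {y} → y ∈ₛ D → y ≢ x → F y) → F x

  spans-flat : ∀ S → Flat (Spans M S)
  spans-flat S = circuit-spans M

  cycle-closed : ∀ {F} → Flat F → ∀ η (C : Cycle Γ n) → gainValue η (Cycle.steps C) ≡ ε →
                 ∀ {x} → x ∈ Cycle.edges C → (∀ {y} → y ∈ Cycle.edges C → y ≢ x → F y) → F x
  cycle-closed flat η C eq x∈ rest =
    flat (Equivalence.from (balanced C ⟦ es ⟧ (edgeSet es)) (gainValue-ε η (Cycle.steps C) (Cycle.isWalk C) eq))
         (∈⟦⟧⁺ es x∈) (λ y∈ → rest (∈⟦⟧⁻ es y∈))
    where es = Cycle.edges C

  module FlatSet {F : E → Set} (flat : Flat F) where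

    -- Two distinct edges with the same ends and the same gain would form a balanced digon, so
    -- exchange covers this case without a proof that the edges coincide.
    parallel : ∀ {η i j g} (s t : StepFrom η i j g) → F (edge s) → F (edge t)
    parallel {η} s t Fs with edge s ≟ edge t
    ... | yes eq = subst F eq Fs
    ... | no s≢t = cycle-closed flat η (digon s t s≢t) (trans (digon-gain s t s≢t) (inverseʳ _))
                     (there (here (sym (edge-fl (step t))))) λ where
                       (here refl) _ → Fs
                       (there (here refl)) y≢ → contradiction (edge-fl (step t)) y≢

    -- There are no loops, so for `i ≡ j` this holds vacuously. Moving a gain to another pair of
    -- vertices must therefore avoid equal ends on the way.
    In : (V → Carrier) → V → V → Carrier → Set
    In η i j g = (s : StepFrom η i j g) → F (edge s)

    In-step : ∀ {η i j g} (s : StepFrom η i j g) → F (edge s) → In η i j g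
    In-step s Fs t = parallel s t Fs

    -- Edges of gains `g`, `h` and `g ∙ h` form a balanced triangle. For `i ≡ k` there is no third
    -- edge `r` to consider.
    In-compose : ∀ {η i j k g h} → i ≢ j → j ≢ k → In η i j g → In η j k h → In η i k (g ∙ h)
    In-compose {η} {g = g} {h} i≢j j≢k Fg Fh r =
      cycle-closed flat η (triangle s t r) eq (there (there (here (sym (edge-fl (step r)))))) λ where
        (here refl) _ → Fg s
        (there (here refl)) _ → Fh t
        (there (there (here refl))) y≢ → contradiction (edge-fl (step r)) y≢
      where
      s = stepFrom η i≢j g
      t = stepFrom η j≢k h
      eq : gainValue η (Cycle.steps (triangle s t r)) ≡ ε
      eq = trans (triangle-gain s t r) (trans (sym (assoc g h _)) (inverseʳ (g ∙ h)))

    In-reverse : ∀ {η i j g} → In η i j g → In η j i (g ⁻¹)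
    In-reverse {η} {i} {j} {g} Fg (mkStep s t h e) =
      subst F (edge-fl s) (Fg (mkStep (fl s) (trans (tl-fl s) h) (trans (hd-fl s) t)
        (trans (gain-fl η s) (trans (cong _⁻¹ e) (⁻¹-involutive g)))))

    In-ε-trans : ∀ {η i j k} → In η i j ε → In η j k ε → In η i k ε
    In-ε-trans {η} {i} {j} {k} p q with i ≟ j | j ≟ k
    ... | yes refl | _        = q
    ... | no _     | yes refl = p
    ... | no i≢j   | no j≢k   = subst (In η i k) (identityˡ ε) (In-compose i≢j j≢k p q)

    In-ε-sym : ∀ {η i j} → In η i j ε → In η j i ε
    In-ε-sym {η} {i} {j} p = subst (In η j i) ε⁻¹≈ε (In-reverse p)

    In-loop : ∀ {η i g} → In η i i g
    In-loop s = contradiction refl (StepFrom-ends≢ s)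

    module Switched {η : V → Carrier} (third : ∀ (i j : V) → ∃[ k ] (k ≢ i × k ≢ j)) (In-ε : ∀ i j → In η i j ε) where

      In-head : ∀ {i j g} → i ≢ j → In η i j g → ∀ k → In η i k g
      In-head {i} {j} {g} i≢j Fg k with j ≟ k
      ... | yes refl = Fg
      ... | no j≢k   = subst (In η i k) (identityʳ g) (In-compose i≢j j≢k Fg (In-ε j k))

      In-tail : ∀ {i j g} → i ≢ j → In η i j g → ∀ k → In η k j g
      In-tail {i} {j} {g} i≢j Fg k with k ≟ i
      ... | yes refl = Fg
      ... | no k≢i   = subst (In η k j) (identityˡ g) (In-compose k≢i i≢j (In-ε k i) Fg)

      -- A direct move could pass through a pair of equal ends and lose all information. The head
      -- first goes to a vertex `w` distinct from `i` and `k`, then the tail to `k`, and finally the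
      -- head to `l`.
      In-transfer : ∀ {i j g} → i ≢ j → In η i j g → ∀ k l → In η k l g
      In-transfer {i} {j} i≢j Fg k l with third i k
      ... | w , w≢i , w≢k = In-head (w≢k ∘ sym) (In-tail (w≢i ∘ sym) (In-head i≢j Fg w) k) l

      -- The second factor is moved to the pair `j`, `w`, composed with the first across a triangle,
      -- and the head is brought back from `w` to `j`.
      In-∙ : ∀ {i j g h} → i ≢ j → In η i j g → In η i j h → In η i j (g ∙ h)
      In-∙ {i} {j} i≢j Fg Fh with third i j
      ... | w , w≢i , w≢j =
        In-head (w≢i ∘ sym) (In-compose i≢j (w≢j ∘ sym) Fg (In-transfer i≢j Fh j w)) j

      In-⁻¹ : ∀ {i j g} → i ≢ j → In η i j g → In η i j (g ⁻¹)
      In-⁻¹ {i} {j} i≢j Fg = In-transfer (i≢j ∘ sym) (In-reverse Fg) i j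

-- Unbalanced handcuffs and theta graphs

module Handcuffs (Γ : FiniteGroup) (n : ℕ) where
  open GainGraph Γ n

  record Line (η : V → Carrier) (u v : V) (ws : List V) : Set where
    field
      steps : List S
      walk  : IsWalk Γ n u v steps
      heads : map hd steps ≡ ws ++ v ∷ []
      gains : ∀ {s} → s ∈ steps → gain η s ≡ ε

  line : ∀ η {u v} ws → Unique (u ∷ ws ++ v ∷ []) → Line η u v ws
  line η [] ((u≢v ∷ []) ∷ _) = record
    { steps = step s ∷ []
    ; walk  = tl≡ s , hd≡ s
    ; heads = cong (_∷ []) (hd≡ s)
    ; gains = λ { (here refl) → gain≡ s }
    }
    where s = stepFrom η u≢v ε
  line η {v = v} (w ∷ ws) ((u≢w ∷ _) ∷ uniq) = record
    { steps = step s ∷ Line.steps rest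
    ; walk  = tl≡ s , subst (λ x → IsWalk Γ n x v (Line.steps rest)) (sym (hd≡ s)) (Line.walk rest)
    ; heads = cong₂ _∷_ (hd≡ s) (Line.heads rest)
    ; gains = λ { (here refl) → gain≡ s ; (there s∈) → Line.gains rest s∈ }
    }
    where
    s = stepFrom η u≢w ε
    rest = line η ws uniq

  walk-ends : ∀ {u v} ss → IsWalk Γ n u v ss → ∀ {s} → s ∈ ss →
              tl s ∈ walkVertices Γ n u ss × hd s ∈ walkVertices Γ n u ss
  walk-ends (s ∷ ss) (refl , walk) (here refl) = here refl , there (here refl)
  walk-ends (s ∷ ss) (refl , walk) (there t∈) with walk-ends ss walk t∈
  ... | p , q = there p , there q

  digon-vertices : ∀ {η i j g h} (s : StepFrom η i j g) (t : StepFrom η i j h) s≢t →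
                   ∀ {x} → x ∈ Cycle.vertices (digon s t s≢t) → x ≡ i ⊎ x ≡ j
  digon-vertices s t _ (here eq)         = inj₁ (trans eq (tl≡ s))
  digon-vertices s t _ (there (here eq)) = inj₂ (trans eq (tl≡ (reverseStep t)))

  -- Digons on `a`, `b` and on `c`, `d` are joined by a path of gain ε from `b` through `ws` to `c`.
  -- Leaving out the edge of gain `β` gives `base`: a path of gain ε through all listed vertices and
  -- one edge of gain `α`. The list `ws` is free, so the path can exhaust the other vertices or be a
  -- single edge.
  module Handcuff {a b c d : V} {ws : List V} (uniq : Unique (a ∷ b ∷ c ∷ d ∷ ws))
    (η : V → Carrier) {α β : Carrier} (α≢ε : α ≢ ε) (β≢ε : β ≢ ε) where
    private
      a-fresh = AllPairs.head uniq
      b-fresh = AllPairs.head (AllPairs.tail uniq)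
      c-fresh = AllPairs.head (AllPairs.tail (AllPairs.tail uniq))

      a≢b : a ≢ b
      a≢b = All.head a-fresh
      a≢c : a ≢ c
      a≢c = All.head (All.tail a-fresh)
      a≢d : a ≢ d
      a≢d = All.head (All.tail (All.tail a-fresh))
      a∉ws : All (a ≢_) ws
      a∉ws = All.tail (All.tail (All.tail a-fresh))
      b≢c : b ≢ c
      b≢c = All.head b-fresh
      b≢d : b ≢ d
      b≢d = All.head (All.tail b-fresh)
      b∉ws : All (b ≢_) ws
      b∉ws = All.tail (All.tail b-fresh)
      c≢d : c ≢ d
      c≢d = All.head c-fresh
      c∉ws : All (c ≢_) ws
      c∉ws = All.tail c-fresh
      d∉ws : All (d ≢_) ws
      d∉ws = AllPairs.head (AllPairs.tail (AllPairs.tail (AllPairs.tail uniq)))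
      ws-unique : Unique ws
      ws-unique = AllPairs.tail (AllPairs.tail (AllPairs.tail (AllPairs.tail uniq)))

    pathVertices : List V
    pathVertices = b ∷ ws ++ c ∷ []

    private
      a∉path : a ∉ pathVertices
      a∉path = Allₚ.All¬⇒¬Any (a≢b ∷ Allₚ.++⁺ a∉ws (a≢c ∷ []))

      d∉path : d ∉ pathVertices
      d∉path = Allₚ.All¬⇒¬Any ((b≢d ∘ sym) ∷ Allₚ.++⁺ d∉ws ((c≢d ∘ sym) ∷ []))

      path-unique : Unique pathVertices
      path-unique = Allₚ.++⁺ b∉ws (b≢c ∷ []) ∷
        Unique.++⁺ ws-unique ([] ∷ []) (λ { (x∈ , here refl) → Allₚ.All¬⇒¬Any c∉ws x∈ })

    ab-ε : StepFrom η a b ε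
    ab-ε = stepFrom η a≢b ε

    ab-α : StepFrom η a b α
    ab-α = stepFrom η a≢b α

    cd-ε : StepFrom η c d ε
    cd-ε = stepFrom η c≢d ε

    cd-β : StepFrom η c d β
    cd-β = stepFrom η c≢d β

    path : Line η b c ws
    path = line η ws path-unique

    pathSteps : List S
    pathSteps = Line.steps path

    vertices≡ : walkVertices Γ n b pathSteps ≡ pathVertices
    vertices≡ = cong (b ∷_) (Line.heads path)

    private
      ab≢ : edge ab-ε ≢ edge ab-α
      ab≢ = edges≢-gain ab-ε ab-α (α≢ε ∘ sym)

      cd≢ : edge cd-ε ≢ edge cd-β
      cd≢ = edges≢-gain cd-ε cd-β (β≢ε ∘ sym)

    handcuff : LooseHandcuff Γ n
    handcuff = record
      { C₁ = digon ab-ε ab-α ab≢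
      ; C₂ = digon cd-ε cd-β cd≢
      ; vertDisj = λ x x∈₁ x∈₂ → disj (digon-vertices ab-ε ab-α ab≢ x∈₁) (digon-vertices cd-ε cd-β cd≢ x∈₂)
      ; u = b
      ; w = c
      ; u∈ = there (here (sym (tl≡ (reverseStep ab-α))))
      ; w∈ = here (sym (tl≡ cd-ε))
      ; P = record { steps = pathSteps ; isWalk = Line.walk path ; distinct = subst Unique (sym vertices≡) path-unique }
      ; meets₁ = λ x x∈P x∈C → meet₁ (subst (x ∈_) vertices≡ x∈P) (digon-vertices ab-ε ab-α ab≢ x∈C)
      ; meets₂ = λ x x∈P x∈C → meet₂ (subst (x ∈_) vertices≡ x∈P) (digon-vertices cd-ε cd-β cd≢ x∈C)
      }
      where
      disj : ∀ {x} → x ≡ a ⊎ x ≡ b → x ≡ c ⊎ x ≡ d → Empty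
      disj (inj₁ refl) (inj₁ eq) = a≢c eq
      disj (inj₁ refl) (inj₂ eq) = a≢d eq
      disj (inj₂ refl) (inj₁ eq) = b≢c eq
      disj (inj₂ refl) (inj₂ eq) = b≢d eq
      meet₁ : ∀ {x} → x ∈ pathVertices → x ≡ a ⊎ x ≡ b → x ≡ b
      meet₁ x∈ (inj₁ refl) = contradiction x∈ a∉path
      meet₁ x∈ (inj₂ eq)   = eq
      meet₂ : ∀ {x} → x ∈ pathVertices → x ≡ c ⊎ x ≡ d → x ≡ c
      meet₂ x∈ (inj₁ eq)   = eq
      meet₂ x∈ (inj₂ refl) = contradiction x∈ d∉path

    edges : List E
    edges = LooseHandcuff.allEdges handcuff

    D : Subset (nEdges Γ n)
    D = ⟦ edges ⟧

    baseEdges : List E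
    baseEdges = edge ab-ε ∷ edge ab-α ∷ edge cd-ε ∷ map proj₁ pathSteps

    base : Subset (nEdges Γ n)
    base = ⟦ baseEdges ⟧

    ab-α∈D : edge ab-α ∈ₛ D
    ab-α∈D = ∈⟦⟧⁺ edges (there (here (sym (edge-fl (step ab-α)))))

    path∈D : ∀ {s} → s ∈ pathSteps → proj₁ s ∈ₛ D
    path∈D s∈ = ∈⟦⟧⁺ edges (there (there (there (there (∈-map⁺ proj₁ s∈)))))

    D-elim : (P : E → Set) → P (edge ab-ε) → P (edge ab-α) → P (edge cd-ε) → P (edge cd-β) →
             (∀ {s} → s ∈ pathSteps → P (proj₁ s)) → ∀ {e} → e ∈ₛ D → P e
    D-elim P p₁ p₂ p₃ p₄ q e∈ with ∈⟦⟧⁻ (edges) e∈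
    ... | here refl                         = p₁
    ... | there (here refl)                 = subst P (sym (edge-fl (step ab-α))) p₂
    ... | there (there (here refl))         = p₃
    ... | there (there (there (here refl))) = subst P (sym (edge-fl (step cd-β))) p₄
    ... | there (there (there (there e∈′))) with ∈-map⁻ proj₁ e∈′
    ...   | s , s∈ , refl = q s∈

    base-elim : (P : E → Set) → P (edge ab-ε) → P (edge ab-α) → P (edge cd-ε) →
                (∀ {s} → s ∈ pathSteps → P (proj₁ s)) → ∀ {e} → e ∈ₛ base → P e
    base-elim P p₁ p₂ p₃ q e∈ with ∈⟦⟧⁻ baseEdges e∈
    ... | here refl                 = p₁
    ... | there (here refl)         = p₂
    ... | there (there (here refl)) = p₃
    ... | there (there (there e∈′)) with ∈-map⁻ proj₁ e∈′
    ...   | s , s∈ , refl = q s∈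

    base⊂D : base ⊂ D
    base⊂D = base-elim (_∈ₛ D) (∈⟦⟧⁺ edges (here refl)) ab-α∈D (∈⟦⟧⁺ edges (there (there (here refl)))) path∈D
           -- The omitted edge witnesses properness: `c` is not an end of the first digon's edges,
           -- `β` differs from ε, and the path avoids `d`.
           , edge cd-β , ∈⟦⟧⁺ edges (there (there (there (here (sym (edge-fl (step cd-β)))))))
           , λ e∈ → base-elim (λ e → edge cd-β ≢ e) (away ab-ε) (away ab-α) (cd≢ ∘ sym) off-path e∈ refl
      where
      away : ∀ {g} (s : StepFrom η a b g) → edge cd-β ≢ edge s
      away s = edges≢-tail {step cd-β} {step s}
        (λ eq → a≢c (trans (sym (tl≡ s)) (trans (sym eq) (tl≡ cd-β))))
        (λ eq → b≢c (trans (sym (hd≡ s)) (trans (sym eq) (tl≡ cd-β))))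
      off-path : ∀ {s} → s ∈ pathSteps → edge cd-β ≢ proj₁ s
      off-path {s} s∈ eq with same-edge (step cd-β) s eq | walk-ends pathSteps (Line.walk path) s∈
      ... | inj₁ (_ , q , _) | _ , h∈ = d∉path (subst₂ _∈_ (trans (sym q) (hd≡ cd-β)) vertices≡ h∈)
      ... | inj₂ (_ , q)     | t∈ , _ = d∉path (subst₂ _∈_ (trans (sym q) (hd≡ cd-β)) vertices≡ t∈)

    frameCircuit : ∀ {H} → IsNormalSubgroup Γ H → α ∉Γ H → β ∉Γ H → FrameCircuit Γ n H D
    frameCircuit {H} normal@((_ , _ , inverse) , _) α∉ β∉ =
      inj₂ (inj₂ (inj₁ (handcuff , edgeSet (edges) , unbalanced ab-ε ab-α ab≢ α∉ , unbalanced cd-ε cd-β cd≢ β∉)))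
      where
      unbalanced : ∀ {i j g} (s : StepFrom η i j ε) (t : StepFrom η i j g) s≢t → g ∉Γ H → Cycle.value (digon s t s≢t) ∉Γ H
      unbalanced {g = g} s t s≢t g∉ v∈ = g∉ (subst (_∈Γ H) (⁻¹-involutive g) (inverse _
        (subst (_∈Γ H) (trans (digon-gain s t s≢t) (identityˡ _))
          (Equivalence.from (gainValue-normal normal η (Cycle.steps C) (Cycle.isWalk C)) v∈))))
        where C = digon s t s≢t

  module ParallelTheta {η : V → Carrier} {i j : V} {α β γ : Carrier}
    (s : StepFrom η i j α) (t : StepFrom η i j β) (r : StepFrom η i j γ)
    (α≢β : α ≢ β) (α≢γ : α ≢ γ) (β≢γ : β ≢ γ) where

    private
      single : ∀ {g} → StepFrom η i j g → Path Γ n i j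
      single s = record
        { steps = step s ∷ []
        ; isWalk = tl≡ s , hd≡ s
        ; distinct = ((λ eq → StepFrom-ends≢ s (trans eq (hd≡ s))) ∷ []) ∷ [] ∷ []
        }
      ends : ∀ {g} (s : StepFrom η i j g) {x} → x ∈ i ∷ hd (step s) ∷ [] → x ≡ i ⊎ x ≡ j
      ends s (here eq)         = inj₁ eq
      ends s (there (here eq)) = inj₂ (trans eq (hd≡ s))
      apart : ∀ {e f : E} → e ≢ f → ∀ x → x ∈ e ∷ [] → x ∉ f ∷ []
      apart e≢f x (here refl) (here eq) = e≢f eq

    theta : Theta Γ n
    theta = record
      { u = i ; v = j ; u≢v = StepFrom-ends≢ s
      ; P₁ = single s ; P₂ = single t ; P₃ = single r
      ; intDisj₁₂ = λ x x∈ _ → ends s x∈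
      ; intDisj₁₃ = λ x x∈ _ → ends s x∈
      ; intDisj₂₃ = λ x x∈ _ → ends t x∈
      ; edgeDisj₁₂ = apart (edges≢-gain s t α≢β)
      ; edgeDisj₁₃ = apart (edges≢-gain s r α≢γ)
      ; edgeDisj₂₃ = apart (edges≢-gain t r β≢γ)
      }

    frameCircuit : ∀ {H} → IsNormalSubgroup Γ H → α ∙ β ⁻¹ ∉Γ H → α ∙ γ ⁻¹ ∉Γ H → β ∙ γ ⁻¹ ∉Γ H →
                   FrameCircuit Γ n H ⟦ edge s ∷ edge t ∷ edge r ∷ [] ⟧
    frameCircuit {H} normal p q r∉ = inj₂ (inj₂ (inj₂ (theta , edgeSet _ , unbalanced s t p , unbalanced s r q , unbalanced t r r∉)))
      where
      unbalanced : ∀ {g h} (s : StepFrom η i j g) (t : StepFrom η i j h) → g ∙ h ⁻¹ ∉Γ H →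
                   walkValue Γ n (step s ∷ step (reverseStep t) ∷ []) ∉Γ H
      unbalanced s t gh∉ v∈ = gh∉ (subst (_∈Γ H)
        (cong₂ _∙_ (gain≡ s) (trans (identityʳ _) (gain≡ (reverseStep t))))
        (Equivalence.from (gainValue-normal normal η (step s ∷ step (reverseStep t) ∷ [])
          (tl≡ s , trans (tl≡ (reverseStep t)) (sym (hd≡ s)) , hd≡ (reverseStep t))) v∈))

-- Switching the trees of handcuffs and theta graphs

module SwitchingTrees (Γ : FiniteGroup) (n : ℕ) (H : FiniteGroup.GSubset Γ) (normal : IsNormalSubgroup Γ H) where
  open GainGraph Γ n

  -- The field `ends` confines the steps to `vs`, so values of the switching elsewhere may be
  -- overwritten when trees are glued.
  record Trivialised (vs : List V) (ss : List S) : Set where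
    field
      η      : V → Carrier
      ends   : ∀ {s} → s ∈ ss → tl s ∈ vs × hd s ∈ vs
      gain-ε : ∀ {s} → s ∈ ss → gain η s ≡ ε

  open Trivialised

  trivialised-[] : ∀ {vs} → Trivialised vs []
  trivialised-[] = record { η = λ _ → ε ; ends = λ () ; gain-ε = λ () }

  trivialised-step : ∀ s → Trivialised (tl s ∷ hd s ∷ []) (s ∷ [])
  trivialised-step s = record
    { η = η′ ; ends = λ { (here refl) → here refl , there (here refl) } ; gain-ε = λ { (here refl) → eq } }
    where
    open ≡-Reasoning
    η′ : V → Carrier
    η′ v with v ≟ hd s
    ... | yes _ = ψ Γ n s ⁻¹
    ... | no _  = ε
    η′-hd : η′ (hd s) ≡ ψ Γ n s ⁻¹
    η′-hd with hd s ≟ hd s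
    ... | yes _ = refl
    ... | no ≢  = contradiction refl ≢
    η′-tl : η′ (tl s) ≡ ε
    η′-tl with tl s ≟ hd s
    ... | yes eq = contradiction eq (tl≢hd s)
    ... | no _   = refl
    eq : gain η′ s ≡ ε
    eq = begin
      η′ (tl s) ⁻¹ ∙ ψ Γ n s ∙ η′ (hd s)   ≡⟨ cong₂ (λ x y → x ⁻¹ ∙ ψ Γ n s ∙ y) η′-tl η′-hd ⟩
      ε ⁻¹ ∙ ψ Γ n s ∙ ψ Γ n s ⁻¹          ≡⟨ cong (λ x → x ∙ ψ Γ n s ∙ ψ Γ n s ⁻¹) ε⁻¹≈ε ⟩
      ε ∙ ψ Γ n s ∙ ψ Γ n s ⁻¹             ≡⟨ cong (_∙ ψ Γ n s ⁻¹) (identityˡ _) ⟩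
      ψ Γ n s ∙ ψ Γ n s ⁻¹                 ≡⟨ inverseʳ _ ⟩
      ε                                    ∎

  weaken : ∀ {vs ws ss} → (∀ {v} → v ∈ vs → v ∈ ws) → Trivialised vs ss → Trivialised ws ss
  weaken vs⊆ws t = record
    { η = η t ; ends = λ s∈ → vs⊆ws (proj₁ (ends t s∈)) , vs⊆ws (proj₂ (ends t s∈)) ; gain-ε = gain-ε t }

  -- Multiplying a switching on the right by a constant conjugates all gains, so the second
  -- switching can be made to agree with the first at the common vertex.
  glue : ∀ {vs₁ vs₂ ss₁ ss₂} x → Trivialised vs₁ ss₁ → Trivialised vs₂ ss₂ →
         (∀ {v} → v ∈ vs₁ → v ∈ vs₂ → v ≡ x) → Trivialised (vs₁ ++ vs₂) (ss₁ ++ ss₂)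
  glue {vs₁} {vs₂} {ss₁} {ss₂} x t₁ t₂ common = record { η = η′ ; ends = ends′ ; gain-ε = gain-ε′ }
    where
    open ≡-Reasoning
    c : Carrier
    c = η t₂ x ⁻¹ ∙ η t₁ x
    η′ : V → Carrier
    η′ v with mem? _≟_ v vs₂
    ... | yes _ = η t₂ v ∙ c
    ... | no _  = η t₁ v
    on₁ : ∀ {v} → v ∈ vs₁ → η′ v ≡ η t₁ v
    on₁ {v} v∈ with mem? _≟_ v vs₂
    ... | no _ = refl
    ... | yes v∈₂ with common v∈ v∈₂
    ...   | refl = \\-leftDividesˡ (η t₂ v) (η t₁ v)
    on₂ : ∀ {v} → v ∈ vs₂ → η′ v ≡ η t₂ v ∙ c
    on₂ {v} v∈ with mem? _≟_ v vs₂
    ... | yes _ = refl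
    ... | no v∉ = contradiction v∈ v∉
    ends′ : ∀ {s} → s ∈ ss₁ ++ ss₂ → tl s ∈ vs₁ ++ vs₂ × hd s ∈ vs₁ ++ vs₂
    ends′ s∈ with ∈-++⁻ ss₁ s∈
    ... | inj₁ s∈₁ = ∈-++⁺ˡ (proj₁ (ends t₁ s∈₁)) , ∈-++⁺ˡ (proj₂ (ends t₁ s∈₁))
    ... | inj₂ s∈₂ = ∈-++⁺ʳ vs₁ (proj₁ (ends t₂ s∈₂)) , ∈-++⁺ʳ vs₁ (proj₂ (ends t₂ s∈₂))
    gain-ε′ : ∀ {s} → s ∈ ss₁ ++ ss₂ → gain η′ s ≡ ε
    gain-ε′ {s} s∈ with ∈-++⁻ ss₁ s∈
    ... | inj₁ s∈₁ = trans (cong₂ (λ y z → y ⁻¹ ∙ ψ Γ n s ∙ z) (on₁ (proj₁ (ends t₁ s∈₁))) (on₁ (proj₂ (ends t₁ s∈₁)))) (gain-ε t₁ s∈₁)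
    ... | inj₂ s∈₂ = begin
      η′ (tl s) ⁻¹ ∙ ψ Γ n s ∙ η′ (hd s)
        ≡⟨ cong₂ (λ y z → y ⁻¹ ∙ ψ Γ n s ∙ z) (on₂ (proj₁ (ends t₂ s∈₂))) (on₂ (proj₂ (ends t₂ s∈₂))) ⟩
      (η t₂ (tl s) ∙ c) ⁻¹ ∙ ψ Γ n s ∙ (η t₂ (hd s) ∙ c)
        ≡⟨ cong (λ z → z ∙ ψ Γ n s ∙ (η t₂ (hd s) ∙ c)) (⁻¹-anti-homo-∙ (η t₂ (tl s)) c) ⟩
      c ⁻¹ ∙ η t₂ (tl s) ⁻¹ ∙ ψ Γ n s ∙ (η t₂ (hd s) ∙ c)
        ≡⟨ sym (assoc _ (η t₂ (hd s)) c) ⟩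
      c ⁻¹ ∙ η t₂ (tl s) ⁻¹ ∙ ψ Γ n s ∙ η t₂ (hd s) ∙ c
        ≡⟨ cong (λ z → z ∙ η t₂ (hd s) ∙ c) (assoc (c ⁻¹) _ _) ⟩
      c ⁻¹ ∙ (η t₂ (tl s) ⁻¹ ∙ ψ Γ n s) ∙ η t₂ (hd s) ∙ c
        ≡⟨ cong (_∙ c) (assoc (c ⁻¹) _ _) ⟩
      c ⁻¹ ∙ gain (η t₂) s ∙ c
        ≡⟨ cong (λ z → c ⁻¹ ∙ z ∙ c) (gain-ε t₂ s∈₂) ⟩
      c ⁻¹ ∙ ε ∙ c
        ≡⟨ conj-ε c ⟩
      ε ∎

  glue-step : ∀ {vs ss} s → Trivialised vs ss → hd s ∈ vs → tl s ∉ vs → Trivialised (tl s ∷ vs) (s ∷ ss)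
  glue-step {vs} s t hd∈ tl∉ =
    weaken (λ { (here eq) → here eq ; (there (here refl)) → there hd∈ ; (there (there v∈)) → there v∈ })
      (glue (hd s) (trivialised-step s) t λ { (here refl) v∈ → contradiction v∈ tl∉ ; (there (here eq)) _ → eq })

  trivialised-path : ∀ {u v} ss → IsWalk Γ n u v ss → Unique (walkVertices Γ n u ss) → Trivialised (walkVertices Γ n u ss) ss
  trivialised-path [] _ _ = trivialised-[]
  trivialised-path (s ∷ ss) (refl , walk) (fresh ∷ uniq) =
    glue-step s (trivialised-path ss walk uniq) (here refl) (Allₚ.All¬⇒¬Any fresh)

  record Opened (vs : List V) (ss : List S) : Set where
    field
      chord       : S
      tree        : List S
      split       : ∀ {s} → s ∈ ss → s ≡ chord ⊎ s ∈ tree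
      trivialised : Trivialised vs tree

  open Opened

  -- The last step becomes the chord, so the other steps form a path on the tails alone. These are
  -- all vertices of a cycle, but all except the final vertex of a path.
  opened : ∀ {u v} s ss → IsWalk Γ n u v (s ∷ ss) → Unique (map tl (s ∷ ss)) → Opened (map tl (s ∷ ss)) (s ∷ ss)
  opened s [] _ _ = record { chord = s ; tree = [] ; split = λ { (here eq) → inj₁ eq } ; trivialised = trivialised-[] }
  opened s (t ∷ ss) (refl , walk@(t≡ , _)) (fresh ∷ uniq) = record
    { chord       = chord rest
    ; tree        = s ∷ tree rest
    ; split       = λ { (here eq) → inj₂ (here eq) ; (there r∈) → [ inj₁ , inj₂ ∘ there ]′ (split rest r∈) }
    ; trivialised = glue-step s (trivialised rest) (here (sym t≡)) (Allₚ.All¬⇒¬Any fresh)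
    }
    where rest = opened t ss walk uniq

  openedCycle : (C : Cycle Γ n) → Opened (Cycle.vertices C) (Cycle.steps C)
  openedCycle C = go (Cycle.steps C) (Cycle.isWalk C) (Cycle.nonempty C) (Cycle.distinctV C)
    where
    go : ∀ {u} ss → IsWalk Γ n u u ss → ss ≢ [] → Unique (map tl ss) → Opened (map tl ss) ss
    go []       _    nonempty _    = contradiction refl nonempty
    go (s ∷ ss) walk _        uniq = opened s ss walk uniq

  walkVertices-tails : ∀ {u v} ss → IsWalk Γ n u v ss → walkVertices Γ n u ss ≡ map tl ss ++ v ∷ []
  walkVertices-tails []       refl          = refl
  walkVertices-tails (s ∷ ss) (refl , walk) = cong (tl s ∷_) (walkVertices-tails ss walk)

  init-unique : ∀ {xs : List V} {v} → Unique (xs ++ v ∷ []) → Unique xs × v ∉ xs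
  init-unique {[]} _ = [] , λ ()
  init-unique {x ∷ xs} (fresh ∷ uniq) with init-unique {xs} uniq
  ... | uniq′ , v∉ = Allₚ.++⁻ˡ xs fresh ∷ uniq′
                   , λ { (here refl) → All.head (Allₚ.++⁻ʳ xs fresh) refl ; (there v∈) → v∉ v∈ }

  module OpenedPath {u v : V} (u≢v : u ≢ v) (P : Path Γ n u v) where
    ss : List S
    ss = Path.steps P

    private
      tails : Unique (map tl ss) × v ∉ map tl ss
      tails = init-unique (subst Unique (walkVertices-tails ss (Path.isWalk P)) (Path.distinct P))

      go : ∀ ss → IsWalk Γ n u v ss → Unique (map tl ss) → Opened (map tl ss) ss
      go []       u≡v  _    = contradiction u≡v u≢v
      go (s ∷ ss) walk uniq = opened s ss walk uniq

    opening : Opened (map tl ss) ss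
    opening = go ss (Path.isWalk P) (proj₁ tails)

    v∉tails : v ∉ map tl ss
    v∉tails = proj₂ tails

    tail⇒vertex : ∀ {x} → x ∈ map tl ss → x ∈ walkVertices Γ n u ss
    tail⇒vertex {x} x∈ = subst (x ∈_) (sym (walkVertices-tails ss (Path.isWalk P))) (∈-++⁺ˡ x∈)

  walk-++ : ∀ {u v w} ss {ts} → IsWalk Γ n u v ss → IsWalk Γ n v w ts → IsWalk Γ n u w (ss ++ ts)
  walk-++ []       refl          walk′ = walk′
  walk-++ (s ∷ ss) (refl , walk) walk′ = refl , walk-++ ss walk walk′

  walk-reverse : ∀ {u v} ss → IsWalk Γ n u v ss → IsWalk Γ n v u (reverseWalk Γ n ss)
  walk-reverse [] refl = refl
  walk-reverse {u} {v} (s ∷ ss) (refl , walk) =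
    subst (IsWalk Γ n v u) (sym (unfold-reverse (fl s) (map fl ss)))
      (walk-++ (reverseWalk Γ n ss) (walk-reverse ss walk) (tl-fl s , hd-fl s))

  ∈-reverseWalk⁻ : ∀ {s} ss → s ∈ reverseWalk Γ n ss → ∃[ t ] (t ∈ ss × s ≡ fl t)
  ∈-reverseWalk⁻ ss s∈ = ∈-map⁻ fl (reverse⁻ s∈)

  gainValue∈ : ∀ η ss → (∀ {s} → s ∈ ss → gain η s ∈Γ H) → gainValue η ss ∈Γ H
  gainValue∈ η []       _ = proj₁ (proj₁ normal)
  gainValue∈ η (s ∷ ss) p = proj₁ (proj₂ (proj₁ normal)) _ _ (p (here refl)) (gainValue∈ η ss (p ∘ there))

  -- The common shape of handcuffs and theta graphs: a tree switched to ε and two chords. The gain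
  -- of `chord₁` serves as generator of a flat, into which exchange then brings `chord₂`.
  record NearTree (X : Subset (nEdges Γ n)) : Set where
    field
      η          : V → Carrier
      chord₁     : S
      chord₂     : E
      unbalanced : gain η chord₁ ∉Γ H
      tree       : ∀ {e} → e ∈ₛ X → e ≡ proj₁ chord₁ ⊎ e ≡ chord₂ ⊎ ∃[ s ] (proj₁ s ≡ e × gain η s ≡ ε)

  module _ {vs : List V} {ss : List S} (η : V → Carrier) (O : Opened vs ss) (gain-ε : ∀ {s} → s ∈ tree O → gain η s ≡ ε) where

    opened-gain∈ : gain η (chord O) ∈Γ H → ∀ {s} → s ∈ ss → gain η s ∈Γ H
    opened-gain∈ chord∈ s∈ with split O s∈
    ... | inj₁ refl   = chord∈
    ... | inj₂ s∈tree = subst (_∈Γ H) (sym (gain-ε s∈tree)) (proj₁ (proj₁ normal))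

    opened-edge : ∀ {e} → e ∈ walkEdges Γ n ss → e ≡ proj₁ (chord O) ⊎ ∃[ s ] (proj₁ s ≡ e × gain η s ≡ ε)
    opened-edge e∈ with ∈-map⁻ proj₁ e∈
    ... | s , s∈ , refl with split O s∈
    ...   | inj₁ refl   = inj₁ refl
    ...   | inj₂ s∈tree = inj₂ (s , refl , gain-ε s∈tree)

  -- All other gains on the cycle are ε, so a chord gain in `H` would put the gain of the whole
  -- cycle in `H`.
  openedCycle-unbalanced : ∀ η (C : Cycle Γ n) → (∀ {s} → s ∈ tree (openedCycle C) → gain η s ≡ ε) →
                           Cycle.value C ∉Γ H → gain η (chord (openedCycle C)) ∉Γ H
  openedCycle-unbalanced η C p value∉ chord∈ = value∉
    (Equivalence.to (gainValue-normal normal η (Cycle.steps C) (Cycle.isWalk C))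
      (gainValue∈ η (Cycle.steps C) (opened-gain∈ η (openedCycle C) p chord∈)))

  tightHandcuff-nearTree : ∀ {X} (h : TightHandcuff Γ n) → EdgeSetOf Γ n (TightHandcuff.allEdges h) X →
                           Cycle.value (TightHandcuff.C₁ h) ∉Γ H → NearTree X
  tightHandcuff-nearTree {X} h edges≡ value∉ = record
    { η          = η joined
    ; chord₁     = chord O₁
    ; chord₂     = proj₁ (chord O₂)
    ; unbalanced = openedCycle-unbalanced (η joined) C₁ ε₁ value∉
    ; tree       = λ e∈ → cases (∈-++⁻ (Cycle.edges C₁) (Equivalence.to (edges≡ _) e∈))
    }
    where
    open TightHandcuff h
    O₁ = openedCycle C₁
    O₂ = openedCycle C₂
    joined = glue shared (trivialised O₁) (trivialised O₂) (λ v∈₁ v∈₂ → onlyShared _ v∈₁ v∈₂)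
    ε₁ : ∀ {s} → s ∈ tree O₁ → gain (η joined) s ≡ ε
    ε₁ s∈ = gain-ε joined (∈-++⁺ˡ s∈)
    ε₂ : ∀ {s} → s ∈ tree O₂ → gain (η joined) s ≡ ε
    ε₂ s∈ = gain-ε joined (∈-++⁺ʳ (tree O₁) s∈)
    cases : ∀ {e} → e ∈ Cycle.edges C₁ ⊎ e ∈ Cycle.edges C₂ →
            e ≡ proj₁ (chord O₁) ⊎ e ≡ proj₁ (chord O₂) ⊎ ∃[ s ] (proj₁ s ≡ e × gain (η joined) s ≡ ε)
    cases (inj₁ e∈) = [ inj₁ , inj₂ ∘ inj₂ ]′ (opened-edge (η joined) O₁ ε₁ e∈)
    cases (inj₂ e∈) = inj₂ (opened-edge (η joined) O₂ ε₂ e∈)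

  looseHandcuff-nearTree : ∀ {X} (h : LooseHandcuff Γ n) → EdgeSetOf Γ n (LooseHandcuff.allEdges h) X →
                           Cycle.value (LooseHandcuff.C₁ h) ∉Γ H → NearTree X
  looseHandcuff-nearTree {X} h edges≡ value∉ = record
    { η          = η joined
    ; chord₁     = chord O₁
    ; chord₂     = proj₁ (chord O₂)
    ; unbalanced = openedCycle-unbalanced (η joined) C₁ ε₁ value∉
    ; tree       = λ e∈ → cases (∈-++⁻ (Cycle.edges C₁) (Equivalence.to (edges≡ _) e∈))
    }
    where
    open LooseHandcuff h
    ss = Path.steps P
    O₁ = openedCycle C₁
    O₂ = openedCycle C₂
    joined₁ = glue u (trivialised O₁) (trivialised-path ss (Path.isWalk P) (Path.distinct P)) (λ v∈₁ v∈P → meets₁ _ v∈P v∈₁)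
    common : ∀ {v} → v ∈ Cycle.vertices C₁ ++ walkVertices Γ n u ss → v ∈ Cycle.vertices C₂ → v ≡ w
    common v∈ v∈₂ with ∈-++⁻ (Cycle.vertices C₁) v∈
    ... | inj₁ v∈₁ = contradiction v∈₂ (vertDisj _ v∈₁)
    ... | inj₂ v∈P = meets₂ _ v∈P v∈₂
    joined = glue w joined₁ (trivialised O₂) common
    ε₁ : ∀ {s} → s ∈ tree O₁ → gain (η joined) s ≡ ε
    ε₁ s∈ = gain-ε joined (∈-++⁺ˡ (∈-++⁺ˡ s∈))
    εP : ∀ {s} → s ∈ ss → gain (η joined) s ≡ ε
    εP s∈ = gain-ε joined (∈-++⁺ˡ (∈-++⁺ʳ (tree O₁) s∈))
    ε₂ : ∀ {s} → s ∈ tree O₂ → gain (η joined) s ≡ ε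
    ε₂ s∈ = gain-ε joined (∈-++⁺ʳ (tree O₁ ++ ss) s∈)
    cases : ∀ {e} → e ∈ Cycle.edges C₁ ⊎ e ∈ Cycle.edges C₂ ++ walkEdges Γ n ss →
            e ≡ proj₁ (chord O₁) ⊎ e ≡ proj₁ (chord O₂) ⊎ ∃[ s ] (proj₁ s ≡ e × gain (η joined) s ≡ ε)
    cases (inj₁ e∈) = [ inj₁ , inj₂ ∘ inj₂ ]′ (opened-edge (η joined) O₁ ε₁ e∈)
    cases (inj₂ e∈) with ∈-++⁻ (Cycle.edges C₂) e∈
    ... | inj₁ e∈₂ = inj₂ (opened-edge (η joined) O₂ ε₂ e∈₂)
    ... | inj₂ e∈P with ∈-map⁻ proj₁ e∈P
    ...   | s , s∈ , refl = inj₂ (inj₂ (s , refl , εP s∈))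

  -- The tree consists of all of `P₁` together with `P₂` and `P₃` without their last steps. Without
  -- these steps the paths no longer reach `v`, so they meet only in `u` and can be glued there.
  theta-nearTree : ∀ {X} (t : Theta Γ n) → EdgeSetOf Γ n (Theta.allEdges t) X → Theta.value₁₂ t ∉Γ H → NearTree X
  theta-nearTree {X} t edges≡ value∉ = record
    { η          = η joined
    ; chord₁     = chord O₂
    ; chord₂     = proj₁ (chord O₃)
    ; unbalanced = λ chord∈ → value∉ (Equivalence.to
        (gainValue-normal normal (η joined) (s₁ ++ reverseWalk Γ n s₂) (walk-++ s₁ (Path.isWalk P₁) (walk-reverse s₂ (Path.isWalk P₂))))
        (gainValue∈ (η joined) _ (λ s∈ → gain∈ chord∈ (∈-++⁻ s₁ s∈))))
    ; tree       = λ e∈ → cases (∈-++⁻ (walkEdges Γ n s₁) (Equivalence.to (edges≡ _) e∈))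
    }
    where
    open Theta t
    module Q₂ = OpenedPath u≢v P₂
    module Q₃ = OpenedPath u≢v P₃
    O₂ = Q₂.opening
    O₃ = Q₃.opening
    drop-v : ∀ {x} {vs : List V} → v ∉ vs → x ∈ vs → x ≡ u ⊎ x ≡ v → x ≡ u
    drop-v v∉ x∈ (inj₁ x≡u)  = x≡u
    drop-v v∉ x∈ (inj₂ refl) = contradiction x∈ v∉
    joined₁ = glue u (trivialised-path s₁ (Path.isWalk P₁) (Path.distinct P₁)) (trivialised O₂)
           (λ x∈₁ x∈₂ → drop-v Q₂.v∉tails x∈₂ (intDisj₁₂ _ x∈₁ (Q₂.tail⇒vertex x∈₂)))
    common : ∀ {x} → x ∈ walkVertices Γ n u s₁ ++ map tl s₂ → x ∈ map tl s₃ → x ≡ u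
    common x∈ x∈₃ with ∈-++⁻ (walkVertices Γ n u s₁) x∈
    ... | inj₁ x∈₁ = drop-v Q₃.v∉tails x∈₃ (intDisj₁₃ _ x∈₁ (Q₃.tail⇒vertex x∈₃))
    ... | inj₂ x∈₂ = drop-v Q₃.v∉tails x∈₃ (intDisj₂₃ _ (Q₂.tail⇒vertex x∈₂) (Q₃.tail⇒vertex x∈₃))
    joined = glue u joined₁ (trivialised O₃) common
    ε₁ : ∀ {s} → s ∈ s₁ → gain (η joined) s ≡ ε
    ε₁ s∈ = gain-ε joined (∈-++⁺ˡ (∈-++⁺ˡ s∈))
    ε₂ : ∀ {s} → s ∈ tree O₂ → gain (η joined) s ≡ ε
    ε₂ s∈ = gain-ε joined (∈-++⁺ˡ (∈-++⁺ʳ s₁ s∈))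
    ε₃ : ∀ {s} → s ∈ tree O₃ → gain (η joined) s ≡ ε
    ε₃ s∈ = gain-ε joined (∈-++⁺ʳ (s₁ ++ tree O₂) s∈)
    gain∈ : gain (η joined) (chord O₂) ∈Γ H → ∀ {s} → s ∈ s₁ ⊎ s ∈ reverseWalk Γ n s₂ → gain (η joined) s ∈Γ H
    gain∈ _ (inj₁ s∈) = subst (_∈Γ H) (sym (ε₁ s∈)) (proj₁ (proj₁ normal))
    gain∈ chord∈ (inj₂ s∈) with ∈-reverseWalk⁻ s₂ s∈
    ... | r , r∈ , refl = subst (_∈Γ H) (sym (gain-fl (η joined) r)) (proj₂ (proj₂ (proj₁ normal)) _ (opened-gain∈ (η joined) O₂ ε₂ chord∈ r∈))
    cases : ∀ {e} → e ∈ walkEdges Γ n s₁ ⊎ e ∈ walkEdges Γ n s₂ ++ walkEdges Γ n s₃ →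
            e ≡ proj₁ (chord O₂) ⊎ e ≡ proj₁ (chord O₃) ⊎ ∃[ s ] (proj₁ s ≡ e × gain (η joined) s ≡ ε)
    cases (inj₁ e∈) with ∈-map⁻ proj₁ e∈
    ... | s , s∈ , refl = inj₂ (inj₂ (s , refl , ε₁ s∈))
    cases (inj₂ e∈) with ∈-++⁻ (walkEdges Γ n s₂) e∈
    ... | inj₁ e∈₂ = [ inj₁ , inj₂ ∘ inj₂ ]′ (opened-edge (η joined) O₂ ε₂ e∈₂)
    ... | inj₂ e∈₃ = inj₂ (opened-edge (η joined) O₃ ε₃ e∈₃)

-- Flats of M and their subgroups of gains

⟨_⟩ : ∀ {m} {P : Fin m → Set} → (∀ k → Dec (P k)) → Subset m
⟨ P? ⟩ = tabulate (λ k → does (P? k))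

∈⟨⟩⁺ : ∀ {m} {P : Fin m → Set} (P? : ∀ k → Dec (P k)) {k} → P k → k ∈ₛ ⟨ P? ⟩
∈⟨⟩⁺ P? {k} Pk = lookup⇒[]= k _ (trans (lookup∘tabulate (λ k → does (P? k)) k) (dec-true (P? k) Pk))

∈⟨⟩⁻ : ∀ {m} {P : Fin m → Set} (P? : ∀ k → Dec (P k)) {k} → k ∈ₛ ⟨ P? ⟩ → P k
∈⟨⟩⁻ P? {k} k∈ with P? k | trans (sym (lookup∘tabulate (λ k → does (P? k)) k)) ([]=⇒lookup k∈)
... | yes Pk | _ = Pk

module LiftedFlats (Γ : FiniteGroup) (Γ₁ : FiniteGroup.GSubset Γ) (normal : IsNormalSubgroup Γ Γ₁) (n : ℕ)
  (N M : Matroid (nEdges Γ n)) (frame : IsFrameMatroid Γ n Γ₁ N) (lift : IsElementaryLift M N)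
  (balanced : ∀ (C : Cycle Γ n) X → EdgeSetOf Γ n (Cycle.edges C) X → IsCircuit M X ⇔ Cycle.value C ≡ FiniteGroup.ε Γ)
  {a b c d : Fin n} {ws : List (Fin n)} (uniq : Unique (a ∷ b ∷ c ∷ d ∷ ws)) (cover : ∀ v → v ∈ a ∷ b ∷ c ∷ d ∷ ws) where
  open GainGraph Γ n
  open FlatGains Γ n M balanced
  open Handcuffs Γ n
  open ElementaryLift N M lift
  open SwitchingTrees Γ n Γ₁ normal using (NearTree; tightHandcuff-nearTree; looseHandcuff-nearTree; theta-nearTree)

  a≢b : a ≢ b
  a≢b = All.head (AllPairs.head uniq)

  b≢c : b ≢ c
  b≢c = All.head (AllPairs.head (AllPairs.tail uniq))

  c≢d : c ≢ d
  c≢d = All.head (AllPairs.head (AllPairs.tail (AllPairs.tail uniq)))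

  third : ∀ i j → ∃[ k ] (k ≢ i × k ≢ j)
  third i j with a ≟ i | a ≟ j | b ≟ i | b ≟ j
  ... | no p     | no q     | _        | _        = a , p , q
  ... | _        | _        | no p     | no q     = b , p , q
  ... | yes refl | _        | yes eq   | _        = contradiction (sym eq) a≢b
  ... | _        | yes refl | _        | yes eq   = contradiction (sym eq) a≢b
  ... | yes refl | _        | _        | yes refl = c , All.head (All.tail (AllPairs.head uniq)) ∘ sym , b≢c ∘ sym
  ... | _        | yes refl | yes refl | _        = c , b≢c ∘ sym , All.head (All.tail (AllPairs.head uniq)) ∘ sym

  ε∈Γ₁ : ε ∈Γ Γ₁
  ε∈Γ₁ = proj₁ (proj₁ normal)

  ∉⇒≢ε : ∀ {α} → α ∉Γ Γ₁ → α ≢ ε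
  ∉⇒≢ε α∉ refl = α∉ ε∈Γ₁

  ε∙⁻¹∉ : ∀ {α} → α ∉Γ Γ₁ → ε ∙ α ⁻¹ ∉Γ Γ₁
  ε∙⁻¹∉ {α} α∉ v∈ = α∉ (subst (_∈Γ Γ₁) (trans (cong _⁻¹ (identityˡ _)) (⁻¹-involutive α)) (proj₂ (proj₂ (proj₁ normal)) _ v∈))

  module LabelFlat {α : Carrier} (η : V → Carrier) (α∉ : α ∉Γ Γ₁) where
    private
      module H = Handcuff uniq η (∉⇒≢ε α∉) (∉⇒≢ε α∉)

    base : Subset (nEdges Γ n)
    base = H.base

    F : E → Set
    F = Spans M base

    open FlatSet {F} (spans-flat base) public

    -- Both digons of the handcuff carry `α`, which is outside `Γ₁`, so the handcuff is an
    -- `N`-circuit and `base` is a proper subset of it.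
    base-independent : Independent N base
    base-independent = proj₂ (Equivalence.from (frame H.D) (H.frameCircuit normal α∉ α∉)) H.base H.base⊂D

    F-circuit : ∀ {C} → IsCircuit N C → (∀ {e} → e ∈ₛ C → F e) → IsCircuit M C
    F-circuit = spanned-circuit base-independent

    private
      base-In : ∀ {i j g} (s : StepFrom η i j g) → edge s ∈ H.baseEdges → In η i j g
      base-In s s∈ = In-step s (∈⇒spans M (∈⟦⟧⁺ H.baseEdges s∈))

      ab-In-ε : In η a b ε
      ab-In-ε = base-In H.ab-ε (here refl)

      cd-In-ε : In η c d ε
      cd-In-ε = base-In H.cd-ε (there (there (here refl)))

      walk-In-ε : ∀ {u v} ss → IsWalk Γ n u v ss → (∀ {s} → s ∈ ss → In η (tl s) (hd s) ε) →
                  ∀ {x} → x ∈ walkVertices Γ n u ss → In η u x ε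
      walk-In-ε ss walk p (here refl) = In-loop
      walk-In-ε (s ∷ ss) (refl , walk) p (there x∈) = In-ε-trans (p (here refl)) (walk-In-ε ss walk (p ∘ there) x∈)

      path-In-ε : ∀ {x} → x ∈ H.pathVertices → In η b x ε
      path-In-ε {x} x∈ = walk-In-ε H.pathSteps (Line.walk H.path)
        (λ {s} s∈ → base-In (mkStep s refl refl (Line.gains H.path s∈)) (there (there (there (∈-map⁺ proj₁ s∈)))))
        (subst (x ∈_) (sym H.vertices≡) x∈)

      b-In-ε : ∀ {x} → x ∈ a ∷ b ∷ c ∷ d ∷ ws → In η b x ε
      b-In-ε (here refl)                         = In-ε-sym ab-In-ε
      b-In-ε (there (here refl))                 = In-loop
      b-In-ε (there (there (here refl)))         = path-In-ε (there (∈-++⁺ʳ ws (here refl)))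
      b-In-ε (there (there (there (here refl)))) = In-ε-trans (path-In-ε (there (∈-++⁺ʳ ws (here refl)))) cd-In-ε
      b-In-ε (there (there (there (there x∈))))  = path-In-ε (there (∈-++⁺ˡ x∈))

    -- The base contains a path of gain ε through all vertices, and balanced triangles compose its
    -- edges into every edge of gain ε.
    In-ε : ∀ i j → In η i j ε
    In-ε i j = In-ε-trans (In-ε-sym (b-In-ε (cover i))) (b-In-ε (cover j))

    open Switched third In-ε public

    Label : Carrier → Set
    Label = In η a b

    label-α : Label α
    label-α = base-In H.ab-α (there (here refl))

    label-In : ∀ {g} → Label g → ∀ i j → In η i j g
    label-In = In-transfer a≢b

    In-label : ∀ {i j g} → i ≢ j → In η i j g → Label g
    In-label i≢j p = In-transfer i≢j p a b

    -- Minimality of the closure: only the edges of the base have to be checked. Flats of different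
    -- generators or switchings are compared through this.
    F-least : ∀ S → (∀ {i j} (s : StepFrom η i j ε) → Spans M S (edge s)) → (∀ (s : StepFrom η a b α) → Spans M S (edge s)) →
              ∀ {e} → F e → Spans M S e
    F-least S p q = spans-trans M (H.base-elim (Spans M S) (p H.ab-ε) (q H.ab-α) (p H.cd-ε)
      (λ {s} s∈ → p (mkStep s refl refl (Line.gains H.path s∈))))

    -- For `g` in `Γ₁` other than ε, the digon of gains ε and `g` is an `N`-circuit inside the flat,
    -- hence an `M`-circuit. It is then balanced, which forces `g ≡ ε`.
    label∈Γ₁ : ∀ {g} → Label g → g ∈Γ Γ₁ → g ≡ ε
    label∈Γ₁ {g} p g∈ with g ≟Γ ε
    ... | yes g≡ε = g≡ε
    ... | no g≢ε  = trans (sym (⁻¹-involutive g)) (trans (cong _⁻¹ g⁻¹≡ε) ε⁻¹≈ε)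
      where
      s = stepFrom η a≢b ε
      t = stepFrom η a≢b g
      s≢t = edges≢-gain s t (g≢ε ∘ sym)
      C = digon s t s≢t
      gain-C : gainValue η (Cycle.steps C) ≡ g ⁻¹
      gain-C = trans (digon-gain s t s≢t) (identityˡ _)
      N-circuit : IsCircuit N ⟦ Cycle.edges C ⟧
      N-circuit = Equivalence.from (frame _) (inj₁ (C , edgeSet _ ,
        Equivalence.to (gainValue-normal normal η (Cycle.steps C) (Cycle.isWalk C))
          (subst (_∈Γ Γ₁) (sym gain-C) (proj₂ (proj₂ (proj₁ normal)) g g∈))))
      C⊆F : ∀ {e} → e ∈ Cycle.edges C → F e
      C⊆F (here refl)         = In-ε a b s
      C⊆F (there (here refl)) = subst F (sym (edge-fl (step t))) (p t)
      g⁻¹≡ε : g ⁻¹ ≡ ε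
      g⁻¹≡ε = trans (sym gain-C) (trans (sym (gainValue-walk η (Cycle.steps C) (Cycle.isWalk C)))
        (trans (cong (λ z → η a ⁻¹ ∙ z ∙ η a)
          (Equivalence.to (balanced C _ (edgeSet (Cycle.edges C))) (F-circuit N-circuit (λ e∈ → C⊆F (∈⟦⟧⁻ (Cycle.edges C) e∈)))))
          (conj-ε (η a))))

  -- Independence of generator and switching, conjugation and malnormality

  module _ {η : V → Carrier} {α γ : Carrier} (α∉ : α ∉Γ Γ₁) (γ∉ : γ ∉Γ Γ₁) where
    private
      module P = LabelFlat η α∉
      module Q = LabelFlat η γ∉
      module H = Handcuff uniq η (∉⇒≢ε α∉) (∉⇒≢ε γ∉)

    -- The handcuff with `α` on `a`, `b` and `γ` on `c`, `d` lies in the flat of `α`, so it is an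
    -- `M`-circuit. The flat of `γ` contains all its edges but `ab-α`, and exchange supplies that
    -- one.
    label-symmetric : P.Label γ → Q.Label α
    label-symmetric γ∈ = Q.In-step H.ab-α (spans-flat Q.base M-circuit H.ab-α∈D
      (H.D-elim (λ y → y ≢ edge H.ab-α → Q.F y)
        (λ _ → Q.In-ε a b H.ab-ε) (λ y≢y → contradiction refl y≢y) (λ _ → Q.In-ε c d H.cd-ε)
        (λ _ → Q.label-In Q.label-α c d H.cd-β) (λ {s} s∈ _ → Q.In-ε _ _ (mkStep s refl refl (Line.gains H.path s∈)))))
      where
      M-circuit : IsCircuit M H.D
      M-circuit = P.F-circuit (Equivalence.from (frame H.D) (H.frameCircuit normal α∉ γ∉))
        (H.D-elim P.F (P.In-ε a b H.ab-ε) (P.label-α H.ab-α) (P.In-ε c d H.cd-ε)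
          (P.label-In γ∈ c d H.cd-β) (λ {s} s∈ → P.In-ε _ _ (mkStep s refl refl (Line.gains H.path s∈))))

    label-⊆ : Q.Label α → ∀ {g} → P.Label g → Q.Label g
    label-⊆ α∈ g∈ s = P.F-least Q.base (λ {i} {j} → Q.In-ε i j) α∈ (g∈ s)

  module _ {η η′ : V → Carrier} {α : Carrier} (α∉ : α ∉Γ Γ₁) where
    private
      module P = LabelFlat η α∉
      module Q = LabelFlat η′ α∉

    -- The theta graph of parallel edges of gains ε, `α` and `g` between `i` and `j` is an
    -- `M`-circuit, being an `N`-circuit in the flat for `η`. Its gains are the same under `η′`,
    -- whose flat contains the first two edges and so the third.
    label-agree : ∀ {i j} → i ≢ j → η i ≡ η′ i → η j ≡ η′ j → ∀ {g} → P.Label g → Q.Label g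
    label-agree {i} {j} i≢j eqi eqj {g} g∈ with g ≟Γ ε | g ≟Γ α
    ... | yes refl | _        = Q.In-ε a b
    ... | no _     | yes refl = Q.label-α
    ... | no g≢ε   | no g≢α   = Q.In-label i≢j (Q.In-step (switch r)
        (spans-flat Q.base M-circuit (∈⟦⟧⁺ es (there (there (here refl)))) (λ y∈ → Q-edge (∈⟦⟧⁻ es y∈))))
      where
      s = stepFrom η i≢j ε
      t = stepFrom η i≢j α
      r = stepFrom η i≢j g
      es = edge s ∷ edge t ∷ edge r ∷ []
      switch : ∀ {h} → StepFrom η i j h → StepFrom η′ i j h
      switch {h} u = relabel (trans (cong₂ (λ x y → η′ i ⁻¹ ∙ (x ∙ h ∙ y ⁻¹) ∙ η′ j) eqi eqj) (conj-cancel _ _ _)) (reswitch η′ u)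
      g∉ : g ∉Γ Γ₁
      g∉ g∈Γ₁ = g≢ε (P.label∈Γ₁ g∈ g∈Γ₁)
      -- The product is again a label, and only ε is a label in `Γ₁`.
      αg⁻¹∉ : α ∙ g ⁻¹ ∉Γ Γ₁
      αg⁻¹∉ q = g≢α (sym (x∙y⁻¹≈ε⇒x≈y α g (P.label∈Γ₁ (P.In-∙ a≢b P.label-α (P.In-⁻¹ a≢b g∈)) q)))
      P-edge : ∀ {y} → y ∈ es → P.F y
      P-edge (here refl)                 = P.In-ε i j s
      P-edge (there (here refl))         = P.label-In P.label-α i j t
      P-edge (there (there (here refl))) = P.label-In g∈ i j r
      M-circuit : IsCircuit M ⟦ es ⟧
      M-circuit = P.F-circuit
        (Equivalence.from (frame _) (ParallelTheta.frameCircuit s t r (∉⇒≢ε α∉ ∘ sym) (g≢ε ∘ sym) (g≢α ∘ sym)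
          normal (ε∙⁻¹∉ α∉) (ε∙⁻¹∉ g∉) αg⁻¹∉))
        (λ y∈ → P-edge (∈⟦⟧⁻ es y∈))
      Q-edge : ∀ {y} → y ∈ es → y ≢ edge r → Q.F y
      Q-edge (here refl) _                   = Q.In-ε i j (switch s)
      Q-edge (there (here refl)) _           = Q.label-In Q.label-α i j (switch t)
      Q-edge (there (there (here refl))) y≢y = contradiction refl y≢y

  -- The labels at a switching η depend only on its values at any two vertices, so comparing
  -- through a switching that agrees with η at a, b and with η′ at c, d removes the dependence.
  label-switch : ∀ {η η′ α} (α∉ : α ∉Γ Γ₁) {g} → LabelFlat.Label η α∉ g → LabelFlat.Label η′ α∉ g
  label-switch {η} {η′} α∉ g∈ =
    label-agree α∉ c≢d (mixed-c) (mixed-d) (label-agree {η} {mixed} α∉ a≢b (sym mixed-a) (sym mixed-b) g∈)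
    where
    mixed : V → Carrier
    mixed v with v ≟ a | v ≟ b
    ... | no _ | no _ = η′ v
    ... | _    | _    = η v
    mixed-a : mixed a ≡ η a
    mixed-a with a ≟ a | a ≟ b
    ... | yes _  | yes _ = refl
    ... | yes _  | no _  = refl
    ... | no a≢a | _     = contradiction refl a≢a
    mixed-b : mixed b ≡ η b
    mixed-b with b ≟ a | b ≟ b
    ... | yes _ | yes _  = refl
    ... | no _  | yes _  = refl
    ... | _     | no b≢b = contradiction refl b≢b
    away : ∀ v → v ≢ a → v ≢ b → mixed v ≡ η′ v
    away v v≢a v≢b with v ≟ a | v ≟ b
    ... | yes p | _     = contradiction p v≢a
    ... | no _  | yes p = contradiction p v≢b
    ... | no _  | no _  = refl
    mixed-c : mixed c ≡ η′ c
    mixed-c = away c (All.head (All.tail (AllPairs.head uniq)) ∘ sym) (b≢c ∘ sym)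
    mixed-d : mixed d ≡ η′ d
    mixed-d = away d (All.head (All.tail (All.tail (AllPairs.head uniq))) ∘ sym) (All.head (All.tail (AllPairs.head (AllPairs.tail uniq))) ∘ sym)

  unswitched : V → Carrier
  unswitched _ = ε

  module _ {α : Carrier} (α∉ : α ∉Γ Γ₁) (γ : Carrier) where
    private
      γ-everywhere : V → Carrier
      γ-everywhere _ = γ

    conj∉ : γ ⁻¹ ∙ α ∙ γ ∉Γ Γ₁
    conj∉ p = α∉ (normal-conj⁻ normal γ α p)

    private
      module P = LabelFlat unswitched α∉
      module Q = LabelFlat γ-everywhere conj∉

      to-γ : ∀ {i j g} → StepFrom unswitched i j g → StepFrom γ-everywhere i j (γ ⁻¹ ∙ g ∙ γ)
      to-γ {g = g} s = relabel (cong (λ z → γ ⁻¹ ∙ z ∙ γ) (ε-conjʳ g)) (reswitch γ-everywhere s)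

      from-γ : ∀ {i j g} → StepFrom γ-everywhere i j g → StepFrom unswitched i j (γ ∙ g ∙ γ ⁻¹)
      from-γ s = relabel (ε-conjˡ _) (reswitch unswitched s)

    -- Under the constant switching `γ` all gains are conjugated, so generators of the flat for `α`
    -- become generators of the flat for `γ ⁻¹ ∙ α ∙ γ`. Then `label-switch` returns to the trivial
    -- switching.
    label-conj : ∀ {g} → P.Label g → LabelFlat.Label unswitched conj∉ (γ ⁻¹ ∙ g ∙ γ)
    label-conj {g} g∈ = label-switch conj∉ (Q.In-step (to-γ s)
      (P.F-least Q.base (λ {i} {j} t → Q.In-ε i j (relabel (conj-ε γ) (to-γ t))) (λ t → Q.label-α (to-γ t)) (g∈ s)))
      where s = stepFrom unswitched a≢b g

    label-conj⁻ : ∀ {g} → LabelFlat.Label unswitched conj∉ g → P.Label (γ ∙ g ∙ γ ⁻¹)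
    label-conj⁻ {g} g∈ = P.In-step (from-γ s)
      (Q.F-least P.base
        (λ {i} {j} t → P.In-ε i j (relabel (trans (cong (_∙ γ ⁻¹) (identityʳ γ)) (inverseʳ γ)) (from-γ t)))
        (λ t → P.label-α (relabel (conj-cancel′ γ α γ) (from-γ t))) (label-switch conj∉ g∈ s))
      where s = stepFrom γ-everywhere a≢b g

  -- A loose handcuff on a, b, c, d with both digons labelled in A has all its edges in the flat of A.
  -- After switching by γ at c and d, all but the connecting edge lie in the flat of A again,
  -- hence so does the connecting edge, whose label has become γ.
  module _ {α : Carrier} (α∉ : α ∉Γ Γ₁) (γ g : Carrier) where
    private
      η : V → Carrier
      η v with v ≟ c | v ≟ d
      ... | no _ | no _ = ε
      ... | _    | _    = γ

      a-fresh = AllPairs.head uniq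
      b-fresh = AllPairs.head (AllPairs.tail uniq)
      c-fresh = AllPairs.head (AllPairs.tail (AllPairs.tail uniq))

      away : ∀ v → v ≢ c → v ≢ d → η v ≡ ε
      away v v≢c v≢d with v ≟ c | v ≟ d
      ... | yes p | _     = contradiction p v≢c
      ... | no _  | yes p = contradiction p v≢d
      ... | no _  | no _  = refl
      η-a : η a ≡ ε
      η-a = away a (All.head (All.tail a-fresh)) (All.head (All.tail (All.tail a-fresh)))
      η-b : η b ≡ ε
      η-b = away b (All.head b-fresh) (All.head (All.tail b-fresh))
      η-c : η c ≡ γ
      η-c with c ≟ c | c ≟ d
      ... | no c≢c | _     = contradiction refl c≢c
      ... | yes _  | yes _ = refl
      ... | yes _  | no _  = refl
      η-d : η d ≡ γ
      η-d with d ≟ c | d ≟ d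
      ... | _     | no d≢d = contradiction refl d≢d
      ... | yes _ | yes _  = refl
      ... | no _  | yes _  = refl

      -- With no further vertices listed, the connecting path is a single edge from `b` to `c`.
      short : Unique (a ∷ b ∷ c ∷ d ∷ [])
      short = (All.head a-fresh ∷ All.head (All.tail a-fresh) ∷ All.head (All.tail (All.tail a-fresh)) ∷ [])
            ∷ (All.head b-fresh ∷ All.head (All.tail b-fresh) ∷ [])
            ∷ (All.head c-fresh ∷ []) ∷ [] ∷ []

      module P = LabelFlat unswitched α∉
      module Q = LabelFlat η α∉

      switched : ∀ {i j h x y} → η i ≡ x → η j ≡ y → StepFrom unswitched i j h → StepFrom η i j (x ⁻¹ ∙ h ∙ y)
      switched {h = h} p q s = relabel (cong₂ _∙_ (cong₂ (λ x z → x ⁻¹ ∙ z) p (ε-conjʳ h)) q) (reswitch η s)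

    label-malnormal : P.Label g → P.Label (γ ⁻¹ ∙ g ∙ γ) → g ≢ ε → P.Label γ
    label-malnormal g∈ g′∈ g≢ε = label-switch α∉
      (Q.In-label b≢c (Q.In-step
        (relabel (trans (cong (λ z → z ∙ ε ∙ γ) ε⁻¹≈ε) (trans (cong (_∙ γ) (identityˡ ε)) (identityˡ γ))) (switched η-b η-c bc))
        (spans-flat Q.base M-circuit (H.path∈D (here refl))
          (H.D-elim (λ y → y ≢ edge bc → Q.F y)
            (λ _ → Q.In-ε a b (relabel (ε-conjˡ ε) (switched η-a η-b H.ab-ε)))
            (λ _ → label-switch α∉ g∈ (relabel (ε-conjˡ g) (switched η-a η-b H.ab-α)))
            (λ _ → Q.In-ε c d (relabel (conj-ε γ) (switched η-c η-d H.cd-ε)))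
            (λ _ → Q.label-In (label-switch α∉ g′∈) c d (switched η-c η-d H.cd-β))
            (λ { (here refl) y≢y → contradiction refl y≢y })))))
      where
      g∉ : g ∉Γ Γ₁
      g∉ p = g≢ε (P.label∈Γ₁ g∈ p)
      module H = Handcuff short unswitched (∉⇒≢ε g∉) (∉⇒≢ε g∉)
      bc : StepFrom unswitched b c ε
      bc = mkStep (lookup H.pathSteps Fin.zero) (proj₁ (Line.walk H.path)) (proj₂ (Line.walk H.path)) (Line.gains H.path (here refl))
      M-circuit : IsCircuit M H.D
      M-circuit = P.F-circuit (Equivalence.from (frame H.D) (H.frameCircuit normal g∉ g∉))
        (H.D-elim P.F (P.In-ε a b H.ab-ε) (g∈ H.ab-α) (P.In-ε c d H.cd-ε) (P.label-In g∈ c d H.cd-β)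
          (λ {s} s∈ → P.In-ε _ _ (mkStep s refl refl (Line.gains H.path s∈))))

  -- The partition of the group

  module _ {α : Carrier} (α∉ : α ∉Γ Γ₁) where
    private
      module P = LabelFlat unswitched α∉

      base-step : ∀ g → StepFrom unswitched a b g
      base-step = stepFrom unswitched a≢b

      spanned? : ∀ k → Dec (P.F (edge (base-step (decode k))))
      spanned? k = spans? M P.base (edge (base-step (decode k)))

    abstract
      -- One representative edge is tested for each group element. By `In-step` the choice of
      -- representative is immaterial.
      labels : GSubset
      labels = ⟨ spanned? ⟩

      ∈labels⁺ : ∀ {g} → P.Label g → g ∈Γ labels
      ∈labels⁺ {g} g∈ = ∈⟨⟩⁺ spanned? (g∈ (relabel (decode-code g) (base-step (decode (code g)))))

      ∈labels⁻ : ∀ {g} → g ∈Γ labels → P.Label g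
      ∈labels⁻ {g} g∈ = P.In-step (relabel (decode-code g) (base-step (decode (code g)))) (∈⟨⟩⁻ spanned? g∈)

    labels-subgroup : IsSubgroup Γ labels
    labels-subgroup = ∈labels⁺ (P.In-ε a b)
                    , (λ x y x∈ y∈ → ∈labels⁺ (P.In-∙ a≢b (∈labels⁻ x∈) (∈labels⁻ y∈)))
                    , (λ x x∈ → ∈labels⁺ (P.In-⁻¹ a≢b (∈labels⁻ x∈)))

    labels-malnormal : IsMalnormal Γ labels
    labels-malnormal γ γ∉ x x∈ (g , g∈ , refl) with x ≟Γ ε
    ... | yes x≡ε = x≡ε
    ... | no x≢ε  = contradiction (∈labels⁺ (label-malnormal α∉ γ g (∈labels⁻ g∈) (∈labels⁻ x∈) g≢ε)) γ∉
      where
      g≢ε : g ≢ ε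
      g≢ε refl = x≢ε (conj-ε γ)

  labels-conj : ∀ {α} (α∉ : α ∉Γ Γ₁) γ x → x ∈Γ labels (conj∉ α∉ γ) ⇔ InConjugate Γ γ (labels α∉) x
  labels-conj α∉ γ x = mk⇔
    (λ x∈ → γ ∙ x ∙ γ ⁻¹ , ∈labels⁺ α∉ (label-conj⁻ α∉ γ (∈labels⁻ (conj∉ α∉ γ) x∈)) , sym (conj-cancel γ x γ))
    (λ { (g , g∈ , refl) → ∈labels⁺ (conj∉ α∉ γ) (label-conj α∉ γ (∈labels⁻ α∉ g∈)) })

  subset-ext : ∀ {P Q} → (∀ x → x ∈Γ P → x ∈Γ Q) → P ⊆ Q
  subset-ext {P} {Q} p {k} k∈ = subst (_∈ₛ Q) code-decode (p (decode k) (subst (_∈ₛ P) (sym code-decode) k∈))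
    where
    code-decode : code (decode k) ≡ k
    code-decode = Inverse.strictlyInverseˡ enumeration k

  -- Each element of the subgroup outside `Γ₁` generates the same flat. The result is an equality of
  -- subsets because the partition compares its members by equality.
  labels-≡ : ∀ {α γ} (α∉ : α ∉Γ Γ₁) (γ∉ : γ ∉Γ Γ₁) → γ ∈Γ labels α∉ → labels α∉ ≡ labels γ∉
  labels-≡ α∉ γ∉ γ∈ = ⊆-antisym
    (subset-ext λ x x∈ → ∈labels⁺ γ∉ (label-⊆ α∉ γ∉ (label-symmetric α∉ γ∉ γ∈′) (∈labels⁻ α∉ x∈)))
    (subset-ext λ x x∈ → ∈labels⁺ α∉ (label-⊆ γ∉ α∉ γ∈′ (∈labels⁻ γ∉ x∈)))
    where γ∈′ = ∈labels⁻ α∉ γ∈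

  -- A subgroup is listed once for each `α` outside `Γ₁` that generates it. Repetitions are
  -- harmless, since uniqueness in a partition concerns equality of members, not positions.
  𝒜 : List GSubset
  𝒜 = concatMap labelsOf elements
    module 𝒜 where
    labelsOf : Carrier → List GSubset
    labelsOf α with α ∈Γ? Γ₁
    ... | yes _ = []
    ... | no α∉ = labels α∉ ∷ []

  ∈𝒜⁻ : ∀ {P} → P ∈ 𝒜 → ∃[ α ] Σ (α ∉Γ Γ₁) λ α∉ → P ≡ labels α∉
  ∈𝒜⁻ {P} P∈ with find (∈-concatMap⁻ 𝒜.labelsOf {xs = elements} P∈)
  ... | α , _ , P∈α with α ∈Γ? Γ₁ | P∈α
  ...   | no α∉ | here refl = α , α∉ , refl

  label∈ : ∀ {α} (α∉ : α ∉Γ Γ₁) → α ∈Γ labels α∉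
  label∈ α∉ = ∈labels⁺ α∉ (LabelFlat.label-α unswitched α∉)

  ∈𝒜⁺ : ∀ {α} (α∉ : α ∉Γ Γ₁) → labels α∉ ∈ 𝒜
  ∈𝒜⁺ {α} α∉ = ∈-concatMap⁺ 𝒜.labelsOf (lose (∈-elements α) ∈labelsOf)
    where
    ∈labelsOf : labels α∉ ∈ 𝒜.labelsOf α
    ∈labelsOf with α ∈Γ? Γ₁
    ... | yes α∈ = contradiction α∈ α∉
    -- The decision returns its own proof that `α` is outside `Γ₁`, and `labels` takes the proof as
    -- an argument. The two versions are identified through the shared label `α`.
    ... | no α∉′ = here (labels-≡ α∉ α∉′ (label∈ α∉))

  partition : IsPartition Γ (Γ₁ ∷ 𝒜)
  partition = proj₁ normal ∷ All.tabulate (λ P∈ → subgroup (∈𝒜⁻ P∈)) , λ γ γ≢ε → covered γ , unique γ γ≢ε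
    where
    subgroup : ∀ {P} → (∃[ α ] Σ (α ∉Γ Γ₁) λ α∉ → P ≡ labels α∉) → IsSubgroup Γ P
    subgroup (_ , α∉ , refl) = labels-subgroup α∉
    covered : ∀ γ → ∃[ P ] (P ∈ Γ₁ ∷ 𝒜 × γ ∈Γ P)
    covered γ with γ ∈Γ? Γ₁
    ... | yes γ∈ = Γ₁ , here refl , γ∈
    ... | no γ∉  = labels γ∉ , there (∈𝒜⁺ γ∉) , label∈ γ∉
    meets-Γ₁ : ∀ {γ P} → P ∈ 𝒜 → γ ∈Γ P → γ ∈Γ Γ₁ → γ ≡ ε
    meets-Γ₁ P∈ γ∈P γ∈ with ∈𝒜⁻ P∈
    ... | _ , α∉ , refl = LabelFlat.label∈Γ₁ unswitched α∉ (∈labels⁻ α∉ γ∈P) γ∈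
    unique : ∀ γ → γ ≢ ε → ∀ P Q → P ∈ Γ₁ ∷ 𝒜 → Q ∈ Γ₁ ∷ 𝒜 → γ ∈Γ P → γ ∈Γ Q → P ≡ Q
    unique γ γ≢ε P Q (here refl) (here refl) _ _ = refl
    unique γ γ≢ε P Q (here refl) (there Q∈) γ∈P γ∈Q = contradiction (meets-Γ₁ Q∈ γ∈Q γ∈P) γ≢ε
    unique γ γ≢ε P Q (there P∈) (here refl) γ∈P γ∈Q = contradiction (meets-Γ₁ P∈ γ∈P γ∈Q) γ≢ε
    unique γ γ≢ε P Q (there P∈) (there Q∈) γ∈P γ∈Q with ∈𝒜⁻ P∈ | ∈𝒜⁻ Q∈
    ... | _ , α∉ , refl | _ , β∉ , refl = trans (labels-≡ α∉ γ∉ γ∈P) (sym (labels-≡ β∉ γ∉ γ∈Q))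
      where
      γ∉ : γ ∉Γ Γ₁
      γ∉ γ∈ = γ≢ε (meets-Γ₁ P∈ γ∈P γ∈)

  malnormal : All (IsMalnormal Γ) 𝒜
  malnormal = All.tabulate λ P∈ → go (∈𝒜⁻ P∈)
    where
    go : ∀ {P} → (∃[ α ] Σ (α ∉Γ Γ₁) λ α∉ → P ≡ labels α∉) → IsMalnormal Γ P
    go (_ , α∉ , refl) = labels-malnormal α∉

  conjugationClosed : ConjugationClosed Γ 𝒜
  conjugationClosed P P∈ γ with ∈𝒜⁻ P∈
  ... | _ , α∉ , refl = labels (conj∉ α∉ γ) , ∈𝒜⁺ (conj∉ α∉ γ) , labels-conj α∉ γ

  -- Frame circuits that are circuits of the lift

  labelled⇒M-circuit : ∀ {C η P} → IsCircuit N C → P ∈ 𝒜 → (∀ e → e ∈ₛ C → ∀ o → gain η (e , o) ∈Γ P) → IsCircuit M C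
  labelled⇒M-circuit {η = η} circ P∈ C⊆ with ∈𝒜⁻ P∈
  -- The flat is taken at the switching `η` that labels the circuit. Its labels are those of the
  -- trivial switching, so it contains every edge of the circuit.
  ... | _ , α∉ , refl = Q.F-circuit circ λ {e} e∈ →
      Q.label-In (label-switch α∉ (∈labels⁻ α∉ (C⊆ e e∈ true))) _ _ (stepOf η (e , true))
    where module Q = LabelFlat η α∉

  -- The gain of `chord₁` generates a flat at the switching of the tree. It contains the tree and
  -- `chord₁`, and since `C` is an `M`-circuit, exchange adds `chord₂`.
  M-circuit⇒labelled : ∀ {C} → IsCircuit M C → NearTree C →
                       ∃[ η ] ∃[ A ] (A ∈ 𝒜 × (∀ e → e ∈ₛ C → ∀ o → gain η (e , o) ∈Γ A))
  M-circuit⇒labelled {C} circ near = η , labels unbalanced , ∈𝒜⁺ unbalanced , λ e e∈ o →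
      ∈labels⁺ unbalanced (label-switch unbalanced (Q.In-label (tl≢hd (e , o)) (Q.In-step (stepOf η (e , o)) (C⊆F e∈))))
    where
    open NearTree near
    module Q = LabelFlat η unbalanced
    others : ∀ {e} → e ∈ₛ C → e ≢ chord₂ → Q.F e
    others e∈ e≢ with tree e∈
    ... | inj₁ refl                    = Q.label-In Q.label-α _ _ (stepOf η chord₁)
    ... | inj₂ (inj₁ eq)               = contradiction eq e≢
    ... | inj₂ (inj₂ (s , refl , eq)) = Q.In-ε _ _ (relabel eq (stepOf η s))
    C⊆F : ∀ {e} → e ∈ₛ C → Q.F e
    C⊆F {e} e∈ with e ≟ chord₂
    ... | no e≢    = others e∈ e≢
    ... | yes refl = spans-flat Q.base circ e∈ others

  class⇒M-circuit : ∀ {C} → IsCircuit N C → InCircuitClass Γ n 𝒜 N C → IsCircuit M C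
  class⇒M-circuit circ (_ , inj₁ (W , W≡C , value≡ε))          = Equivalence.from (balanced W _ W≡C) value≡ε
  class⇒M-circuit circ (_ , inj₂ (_ , η , A , A∈ , labelled)) = labelled⇒M-circuit {η = η} circ A∈ labelled

  M-circuit⇒class : ∀ {C} → IsCircuit N C → IsCircuit M C → InCircuitClass Γ n 𝒜 N C
  M-circuit⇒class {C} circ M-circ with Equivalence.to (frame C) circ
  ... | inj₁ (W , W≡C , _) = circ , inj₁ (W , W≡C , Equivalence.to (balanced W C W≡C) M-circ)
  ... | inj₂ (inj₁ (h , h≡C , v∉ , _)) =
    circ , inj₂ (inj₁ (h , h≡C) , M-circuit⇒labelled M-circ (tightHandcuff-nearTree h h≡C v∉))
  ... | inj₂ (inj₂ (inj₁ (h , h≡C , v∉ , _))) =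
    circ , inj₂ (inj₂ (inj₁ (h , h≡C)) , M-circuit⇒labelled M-circ (looseHandcuff-nearTree h h≡C v∉))
  ... | inj₂ (inj₂ (inj₂ (t , t≡C , v∉ , _))) =
    circ , inj₂ (inj₂ (inj₂ (t , t≡C)) , M-circuit⇒labelled M-circ (theta-nearTree t t≡C v∉))

  mConstruction : IsMConstruction Γ n 𝒜 N M
  mConstruction X =
    (λ good → ≤-antisym (circuits⇒unlifted λ C C⊆X circ → class⇒M-circuit circ (good C C⊆X circ)) (N≤M X)) ,
    -- If the ranks agreed, every `N`-circuit in `X` would be unlifted, hence an `M`-circuit and a
    -- member of the class.
    (λ ¬good → ≤-antisym (M≤1+N X) (≰⇒> λ unlifted →
      ¬good λ C C⊆X circ → M-circuit⇒class circ (unlifted-circuit circ (unlifted-⊆ C⊆X unlifted))))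

theorem1p2 : (Γ : FiniteGroup) (Γ₁ : FiniteGroup.GSubset Γ) → IsNormalSubgroup Γ Γ₁ →
    (n : ℕ) → 4 ≤ n →
    (N M : Matroid (nEdges Γ n)) →
    IsFrameMatroid Γ n Γ₁ N →
    IsElementaryLift M N →
    (∀ (C : Cycle Γ n) X → EdgeSetOf Γ n (Cycle.edges C) X →
    (IsCircuit M X ⇔ Cycle.value C ≡ FiniteGroup.ε Γ)) →
    ∃[ 𝒜 ] (IsPartition Γ (Γ₁ ∷ 𝒜) × All (IsMalnormal Γ) 𝒜 ×
    ConjugationClosed Γ 𝒜 × IsMConstruction Γ n 𝒜 N M)
-- Matching on `4 ≤ n` lets `allFin n` unfold to four named vertices followed by the remaining ones.
theorem1p2 Γ Γ₁ normal n (s≤s (s≤s (s≤s (s≤s z≤n)))) N M frame lift balanced =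
  𝒜 , partition , malnormal , conjugationClosed , mConstruction
  where open LiftedFlats Γ Γ₁ normal n N M frame lift balanced (Unique.allFin⁺ n) ∈-allFin
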